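{- For every integer $n\ge 0$, \[ L_n(x;q,y)=\sum_{\pi\in \mathcal{M}_n}(-1)^{e(\pi)}\,y^{\mathrm{bwex}(\pi)}\,q^{\mathrm{bwt}(\pi)+\mathrm{cross}(\pi)}\,x^{\,n-e(\pi)}, \] where $L_n(x;q,y)$ are the $q$-Laguerre polynomials and $\mathcal{M}_n$, $e$, $\mathrm{bwex}$, $\mathrm{bwt}$, $\mathrm{cross}$ are as defined in the context.
   Context: Write $[n]_q=1+q+\dots+q^{n-1}$ and $[n]=\{1,\dots,n\}$. The $q$-Laguerre polynomials $L_n(x;q,y)$ are defined by $L_0=1$, $L_1=x-y$, and for $n\ge 1$, $L_{n+1}(x;q,y)=(x-y[n+1]_q-[n]_q)L_n(x;q,y)-y[n]_q^2L_{n-1}(x;q,y)$. A matching of degree $n$ is a set $\pi$ of edges $(i,\bar j)$ with $i,j\in[n]$ (joining the "upper vertex" $i$ to the "lower vertex" $\bar j$) such that no two distinct edges share an upper vertex or share a lower vertex; $\mathcal{M}_n$ is the set of all matchings of degree $n$ (including the empty one), and $e(\pi)$ is the number of edges of $\pi$. If $(i,\bar j)\in\pi$ write $\pi(i)=j$. An upper (resp. lower) vertex is unmatched if no edge of $\pi$ contains it. The upper block index $\mathrm{bind}^U_\pi(i)$ of an upper vertex $i$ is $1$ plus the number of unmatched upper vertices $u$ with $u<i$; the lower block index $\mathrm{bind}^L_\pi(j)$ of a lower vertex $\bar j$ is $1$ plus the number of unmatched lower vertices $\bar v$ with $v<j$. For an edge $e=(i,\overline{\pi(i)})$, its block difference is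 $\mathrm{bdiff}_\pi(e)=\mathrm{bind}^L_\pi(\pi(i))-\mathrm{bind}^U_\pi(i)$. Then $\mathrm{bwex}(\pi)$ is the number of edges $e$ with $\mathrm{bdiff}_\pi(e)\ge 0$; $\mathrm{bwt}(\pi)=\sum_{e:\,\mathrm{bdiff}_\pi(e)\ge0}\mathrm{bdiff}_\pi(e)+\sum_{e:\,\mathrm{bdiff}_\pi(e)<0}(-\mathrm{bdiff}_\pi(e)-1)$; and $\mathrm{cross}(\pi)$ is the number of pairs of edges $(i,\overline{\pi(i)}),(j,\overline{\pi(j)})$ of $\pi$ with $i<j$ and $\pi(i)>\pi(j)$. -}

module Defs where

open import Data.Nat using (ℕ; zero; suc; _∸_; _<ᵇ_; _≡ᵇ_) renaming (_+_ to _+ℕ_)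
open import Data.Bool using (Bool; true; false; if_then_else_; _∧_; not; _∨_)
open import Data.Fin using (Fin; toℕ)
open import Data.Maybe using (Maybe; just; nothing)
open import Data.Vec using (Vec; []; _∷_; lookup)
open import Data.List using (List; []; _∷_; map; concatMap; allFin; upTo)
open import Algebra.Bundles using (CommutativeRing)

allVecs : ∀ {a} {A : Set a} (k : ℕ) → List A → List (Vec A k)
allVecs zero    xs = [] ∷ []
allVecs (suc k) xs = concatMap (λ a → map (a ∷_) (allVecs k xs)) xs

filterB : ∀ {a} {A : Set a} → (A → Bool) → List A → List A
filterB p []       = []
filterB p (x ∷ xs) = if p x then x ∷ filterB p xs else filterB p xs

count : ∀ {a} {A : Set a} → (A → Bool) → List A → ℕ
count p []       = 0
count p (x ∷ xs) = if p x then suc (count p xs) else count p xs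

anyB : ∀ {a} {A : Set a} → (A → Bool) → List A → Bool
anyB p []       = false
anyB p (x ∷ xs) = p x ∨ anyB p xs

sumℕ : List ℕ → ℕ
sumℕ []       = 0
sumℕ (x ∷ xs) = x +ℕ sumℕ xs

-- Matchings of degree n.
-- Upper vertices and lower vertices are both indexed by Fin n
-- (Fin n's index k stands for vertex k+1).  A matching π is encoded by
-- the partial map i ↦ π(i): entry i is  just j  iff (i, j̄) is an edge,
-- and nothing iff upper vertex i is unmatched.  Such a vector is a
-- matching iff no two distinct upper vertices map to the same lower vertex.

PMap : ℕ → Set
PMap n = Vec (Maybe (Fin n)) n

_≡F_ : ∀ {n} → Fin n → Fin n → Bool
a ≡F b = toℕ a ≡ᵇ toℕ b

_<F_ : ∀ {n} → Fin n → Fin n → Bool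
a <F b = toℕ a <ᵇ toℕ b

sameJust : ∀ {n} → Maybe (Fin n) → Maybe (Fin n) → Bool
sameJust (just a) (just b) = a ≡F b
sameJust _        _        = false

isJust : ∀ {n} → Maybe (Fin n) → Bool
isJust (just _) = true
isJust nothing  = false

isMatching : ∀ {n} → PMap n → Bool
isMatching {n} π =
  not (anyB (λ i → anyB (λ j → (i <F j) ∧ sameJust (lookup π i) (lookup π j))
                        (allFin n))
            (allFin n))

matchings : (n : ℕ) → List (PMap n)
matchings n = filterB isMatching (allVecs n (nothing ∷ map just (allFin n)))

edges : ∀ {n} → PMap n → ℕ
edges {n} π = count (λ i → isJust (lookup π i)) (allFin n)

upperUnmatched : ∀ {n} → PMap n → Fin n → Bool
upperUnmatched π u = not (isJust (lookup π u))

lowerUnmatched : ∀ {n} → PMap n → Fin n → Bool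
lowerUnmatched {n} π v = not (anyB (λ i → sameJust (lookup π i) (just v)) (allFin n))

bindU : ∀ {n} → PMap n → Fin n → ℕ
bindU {n} π i = suc (count (λ u → upperUnmatched π u ∧ (u <F i)) (allFin n))

bindL : ∀ {n} → PMap n → Fin n → ℕ
bindL {n} π j = suc (count (λ v → lowerUnmatched π v ∧ (v <F j)) (allFin n))

bdiffNonneg : ∀ {n} → PMap n → Fin n → Fin n → Bool
bdiffNonneg π i j = not (bindL π j <ᵇ bindU π i)

-- contribution of edge (i, j̄) to bwt:
--   bdiff        if bdiff ≥ 0
--   -bdiff - 1   if bdiff < 0
bwtEdge : ∀ {n} → PMap n → Fin n → Fin n → ℕ
bwtEdge π i j =
  if bdiffNonneg π i j
  then bindL π j ∸ bindU π i
  else (bindU π i ∸ bindL π j) ∸ 1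

bwex : ∀ {n} → PMap n → ℕ
bwex {n} π = count (λ i → edgeNonneg i (lookup π i)) (allFin n)
  where
  edgeNonneg : Fin n → Maybe (Fin n) → Bool
  edgeNonneg i (just j) = bdiffNonneg π i j
  edgeNonneg i nothing  = false

bwt : ∀ {n} → PMap n → ℕ
bwt {n} π = sumℕ (map (λ i → w i (lookup π i)) (allFin n))
  where
  w : Fin n → Maybe (Fin n) → ℕ
  w i (just j) = bwtEdge π i j
  w i nothing  = 0

cross : ∀ {n} → PMap n → ℕ
cross {n} π = sumℕ (map (λ i → count (λ j → (i <F j) ∧ crossing (lookup π i) (lookup π j)) (allFin n)) (allFin n))
  where
  crossing : Maybe (Fin n) → Maybe (Fin n) → Bool
  crossing (just a) (just b) = b <F a
  crossing _        _        = false

-- Polynomial identities are stated by evaluation in an arbitrary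
-- commutative ring R (equivalently, in ℤ[x,q,y] itself).

module _ {c ℓ} (R : CommutativeRing c ℓ) where
  open CommutativeRing R

  pow : Carrier → ℕ → Carrier
  pow a zero    = 1#
  pow a (suc k) = a * pow a k

  sumR : List Carrier → Carrier
  sumR []       = 0#
  sumR (a ∷ as) = a + sumR as

  qint : Carrier → ℕ → Carrier
  qint q n = sumR (map (pow q) (upTo n))

  qLaguerre : (x q y : Carrier) → ℕ → Carrier
  qLaguerre x q y zero          = 1#
  qLaguerre x q y (suc zero)    = x - y
  qLaguerre x q y (suc (suc m)) =
    (x - y * qint q (suc (suc m)) - qint q (suc m)) * qLaguerre x q y (suc m)
    - y * (qint q (suc m) * qint q (suc m)) * qLaguerre x q y m

  matchingWeight : (x q y : Carrier) → (n : ℕ) → PMap n → Carrier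
  matchingWeight x q y n π =
    pow (- 1#) (edges π) * pow y (bwex π) * pow q (bwt π +ℕ cross π) * pow x (n ∸ edges π)

  matchingSum : (x q y : Carrier) → ℕ → Carrier
  matchingSum x q y n = sumR (map (matchingWeight x q y n) (matchings n))

{-# OPTIONS --safe #-}
module Submission where

-- Let S(n) be the matching sum and let M(n) be the sum over matchings of n upper vertices with
-- n - 1 lower vertices.  Removing the last lower vertex of an (n + 1) × (n + 1) matching: if it is
-- free nothing changes, and if it is joined to the upper vertex i, the edge has bdiff ≥ 0 and its
-- bdiff and its crossings together count the upper vertices above i, free and matched.  Hence
-- S(n+1) = M(n+1) - y [n+1] S(n).  Removing the last upper vertex of an (n + 1) × n matching: if it
-- is joined to j, the edge has bdiff < 0 and - bdiff - 1 together with its crossings counts the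
-- lower vertices above j.  Hence M(n+1) = x S(n) - [n] M(n).  Substituting M(n) = S(n) + y [n] S(n-1)
-- gives the three-term recurrence.

open import Defs
open import Data.Nat using (ℕ; zero; suc; _∸_; _<ᵇ_; _≤_; s≤s) renaming (_+_ to _+ℕ_)
import Data.Nat.Properties as ℕₚ
open import Data.Bool using (Bool; true; false; if_then_else_; _∧_; not; _∨_; T)
open import Data.Bool.Properties using (∧-zeroʳ; ∧-identityʳ; ∧-comm; T?; T-∧)
open import Data.Fin using (Fin; zero; suc; toℕ; fromℕ; punchIn; punchOut; opposite; _≟_)
open import Data.Fin.Properties
  using (any?; all?; punchIn-injective; punchInᵢ≢i; punchIn-punchOut; opposite-suc; toℕ-fromℕ; toℕ-injective; suc-injective)
open import Data.Fin.Permutation using (reverse)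
open import Data.List as List using (List; []; _∷_; _++_; concatMap; applyUpTo)
open import Data.List.Properties using (map-++; map-∘; map-tabulate)
open import Data.Maybe as Maybe using (Maybe; just; nothing; maybe′)
open import Data.Maybe.Properties as Maybeₚ using (just-injective; map-injective)
open import Data.Vec as Vec using (Vec; []; _∷_; lookup; insertAt)
open import Data.Vec.Properties using (insertAt-lookup; insertAt-punchIn; lookup-map)
open import Data.Product using (∃; _×_; _,_)
open import Data.Sum using (_⊎_; inj₁; inj₂)
open import Function using (_∘_; id; _⇔_; mk⇔; Equivalence)
open import Relation.Nullary using (¬_; Dec; yes; no; does; contradiction)
open import Relation.Nullary.Decidable using (_→-dec_; ¬?; dec-true; dec-false; does-⇔)
open import Relation.Binary.Definitions using (tri<; tri≈; tri>)
open import Relation.Binary.PropositionalEquality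
  using (_≡_; refl; sym; trans; cong; cong₂; subst; module ≡-Reasoning)
open import Algebra.Bundles using (CommutativeRing; CommutativeMonoid)
import Algebra.Properties.CommutativeMonoid.Sum as Sum
open import Algebra.Properties.CommutativeSemigroup ℕₚ.+-commutativeSemigroup using (interchange)

private variable
  n m N : ℕ
  A : Set

-- Finite sums over a commutative monoid, and counting by indicators.

module FinSum {c ℓ} (M : CommutativeMonoid c ℓ) where
  open CommutativeMonoid M
    renaming (_∙_ to _+_; ε to 0#; refl to ≈-refl; sym to ≈-sym; trans to ≈-trans)

  -- Opaque, so that summands can be inferred from equations between sums.
  opaque
    ∑ : (Fin n → Carrier) → Carrier
    ∑ = Sum.sum M

    ∑-empty : {f : Fin 0 → Carrier} → ∑ f ≈ 0#
    ∑-empty = ≈-refl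

    ∑-suc : (f : Fin (suc n) → Carrier) → ∑ f ≈ f zero + ∑ (f ∘ suc)
    ∑-suc f = ≈-refl

    ∑-cong : {f g : Fin n → Carrier} → (∀ i → f i ≈ g i) → ∑ f ≈ ∑ g
    ∑-cong = Sum.sum-cong-≋ M

    ∑-remove : (i : Fin (suc n)) {f : Fin (suc n) → Carrier} → ∑ f ≈ f i + ∑ (f ∘ punchIn i)
    ∑-remove i {f} = Sum.sum-remove M {i = i} f

    ∑-distrib-+ : {f g : Fin n → Carrier} → ∑ (λ i → f i + g i) ≈ ∑ f + ∑ g
    ∑-distrib-+ {f = f} {g} = Sum.∑-distrib-+ M f g

    ∑-comm : {f : Fin n → Fin m → Carrier} → ∑ (λ i → ∑ (λ j → f i j)) ≈ ∑ (λ j → ∑ (λ i → f i j))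
    ∑-comm {f = f} = Sum.∑-comm M f

    ∑-zero : {f : Fin n → Carrier} → (∀ i → f i ≈ 0#) → ∑ f ≈ 0#
    ∑-zero {n} f≈0 = ≈-trans (∑-cong f≈0) (Sum.sum-replicate-zero M n)

    ∑-opposite : (f : Fin n → Carrier) → ∑ (f ∘ opposite) ≈ ∑ f
    ∑-opposite f = ≈-sym (Sum.sum-permute M f reverse)

open FinSum ℕₚ.+-0-commutativeMonoid

⟦_⟧ : Bool → ℕ
⟦ b ⟧ = if b then 1 else 0

∑-one : ∀ n → ∑ {n} (λ _ → 1) ≡ n
∑-one zero    = ∑-empty
∑-one (suc n) = trans (∑-suc _) (cong suc (∑-one n))

∑-remove-zero : (i : Fin (suc n)) {f : Fin (suc n) → ℕ} → f i ≡ 0 → ∑ f ≡ ∑ (f ∘ punchIn i)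
∑-remove-zero i {f} fi≡0 = trans (∑-remove i) (cong (_+ℕ ∑ (f ∘ punchIn i)) fi≡0)

∑-split : (p r : Fin n → Bool) →
  ∑ (λ i → ⟦ p i ∧ r i ⟧) +ℕ ∑ (λ i → ⟦ p i ∧ not (r i) ⟧) ≡ ∑ (λ i → ⟦ p i ⟧)
∑-split p r = trans (sym ∑-distrib-+) (∑-cong λ i → pointwise (p i) (r i))
  where
  pointwise : ∀ a b → ⟦ a ∧ b ⟧ +ℕ ⟦ a ∧ not b ⟧ ≡ ⟦ a ⟧
  pointwise true  true  = refl
  pointwise true  false = refl
  pointwise false b     = refl

-- Uniqueness leaves at most one nonzero summand, which is split off at the witness. Applied to the
-- entries equal to `just c`, this turns the matching condition into a count.
∑-unique : {P : Fin n → Set} (P? : ∀ i → Dec (P i)) → (∀ {i k} → P i → P k → i ≡ k) →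
  ∑ (λ i → ⟦ does (P? i) ⟧) ≡ ⟦ does (any? P?) ⟧
∑-unique {zero}  P? unique = ∑-empty
∑-unique {suc n} {P} P? unique = go (any? P?)
  where
  go : (d : Dec (∃ P)) → ∑ (λ i → ⟦ does (P? i) ⟧) ≡ ⟦ does d ⟧
  go (no ¬∃) = ∑-zero λ i → cong ⟦_⟧ (dec-false (P? i) λ p → ¬∃ (i , p))
  go (yes (i , p)) = trans (∑-remove i) (cong₂ _+ℕ_
    (cong ⟦_⟧ (dec-true (P? i) p))
    (∑-zero λ k → cong ⟦_⟧ (dec-false (P? (punchIn i k)) λ p′ → punchInᵢ≢i i k (unique p′ p))))

-- Order of indices under insertion of a pivot.

punchIn-<F : (i : Fin (suc n)) (a b : Fin n) → (punchIn i a <F punchIn i b) ≡ (a <F b)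
punchIn-<F zero    a       b       = refl
punchIn-<F (suc i) zero    zero    = refl
punchIn-<F (suc i) zero    (suc b) = refl
punchIn-<F (suc i) (suc a) zero    = refl
punchIn-<F (suc i) (suc a) (suc b) = punchIn-<F i a b

-- `punchIn i k` is never `i`, so not lying above the pivot is the same as lying strictly below it.
punchIn-<F-pivot : (i : Fin (suc n)) (k : Fin n) → (punchIn i k <F i) ≡ not (i <F punchIn i k)
punchIn-<F-pivot zero    k       = refl
punchIn-<F-pivot (suc i) zero    = refl
punchIn-<F-pivot (suc i) (suc k) = punchIn-<F-pivot i k

last-≮ : (k : Fin (suc n)) → (fromℕ n <F k) ≡ false
last-≮ {zero}  zero    = refl
last-≮ {suc n} zero    = refl
last-≮ {suc n} (suc k) = last-≮ k

punchIn-<F-last : (k : Fin n) → (punchIn (fromℕ n) k <F fromℕ n) ≡ true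
punchIn-<F-last {n} k =
  trans (punchIn-<F-pivot (fromℕ n) k) (cong not (last-≮ (punchIn (fromℕ n) k)))

-- `opposite i` measures the distance from `i` to the last index. This number becomes the power of
-- `q` gained by a new edge.
∑-above-pivot : (i : Fin (suc n)) → ∑ (λ k → ⟦ i <F punchIn i k ⟧) ≡ toℕ (opposite i)
∑-above-pivot {n}     zero    = trans (∑-one n) (sym (toℕ-fromℕ n))
∑-above-pivot {suc n} (suc i) = trans (∑-suc _) (trans (∑-above-pivot i) (sym (opposite-suc i)))

punchView : (i k : Fin (suc n)) → k ≡ i ⊎ ∃ λ k′ → k ≡ punchIn i k′
punchView i k with i ≟ k
... | yes i≡k = inj₁ (sym i≡k)
... | no  i≢k = inj₂ (punchOut i≢k , sym (punchIn-punchOut i≢k))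

-- Matchings between N upper and m lower vertices

-- Boards are rectangular because the recurrence passes through sizes with `N = m + 1`; the square
-- case is `PMap n` itself. A board may still use a lower vertex twice.
Board : ℕ → ℕ → Set
Board N m = Vec (Maybe (Fin m)) N

raise : Fin (suc m) → Maybe (Fin m) → Maybe (Fin (suc m))
raise j = Maybe.map (punchIn j)

-- The insertions `addLower`, `addUpper` and `addEdge` undo the removal of a free lower vertex, of a
-- free upper vertex, and of an edge with both its ends. Every statistic is compared along these
-- three maps.
addLower : Fin (suc m) → Board N m → Board N (suc m)
addLower j = Vec.map (raise j)

addUpper : Fin (suc N) → Board N m → Board (suc N) m
addUpper i v = insertAt v i nothing

addEdge : Fin (suc N) → Fin (suc m) → Board N m → Board (suc N) (suc m)
addEdge i j v = insertAt (addLower j v) i (just j)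

lookup-addLower : (j : Fin (suc m)) (v : Board N m) (k : Fin N) →
  lookup (addLower j v) k ≡ raise j (lookup v k)
lookup-addLower j v k = lookup-map k (raise j) v

lookup-addEdge : (i : Fin (suc N)) (j : Fin (suc m)) (v : Board N m) (k : Fin N) →
  lookup (addEdge i j v) (punchIn i k) ≡ raise j (lookup v k)
lookup-addEdge i j v k = trans (insertAt-punchIn (addLower j v) i (just j) k) (lookup-addLower j v k)

lookup-addEdge-pivot : (i : Fin (suc N)) (j : Fin (suc m)) (v : Board N m) →
  lookup (addEdge i j v) i ≡ just j
lookup-addEdge-pivot i j v = insertAt-lookup (addLower j v) i (just j)

lookup-addUpper : (i : Fin (suc N)) (v : Board N m) (k : Fin N) →
  lookup (addUpper i v) (punchIn i k) ≡ lookup v k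
lookup-addUpper i v = insertAt-punchIn v i nothing

raise≢pivot : (j : Fin (suc m)) (a : Maybe (Fin m)) → ¬ raise j a ≡ just j
raise≢pivot j (just c) eq = punchInᵢ≢i j c (just-injective eq)

raise-injective : (j : Fin (suc m)) {a b : Maybe (Fin m)} → raise j a ≡ raise j b → a ≡ b
raise-injective j = map-injective λ {c} {d} → punchIn-injective j c d

_≟M_ : (a b : Maybe (Fin m)) → Dec (a ≡ b)
_≟M_ = Maybeₚ.≡-dec _≟_

Covered : Board N m → Fin m → Set
Covered v c = ∃ λ k → lookup v k ≡ just c

covered? : (v : Board N m) (c : Fin m) → Dec (Covered v c)
covered? v c = any? λ k → lookup v k ≟M just c

covered-addEdge : (i : Fin (suc N)) (j : Fin (suc m)) (v : Board N m) (c : Fin m) →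
  Covered (addEdge i j v) (punchIn j c) ⇔ Covered v c
covered-addEdge i j v c = mk⇔ to from
  where
  to : Covered (addEdge i j v) (punchIn j c) → Covered v c
  to (k , eq) with punchView i k
  ... | inj₁ refl =
    contradiction (sym (just-injective (trans (sym (lookup-addEdge-pivot i j v)) eq))) (punchInᵢ≢i j c)
  ... | inj₂ (k′ , refl) = k′ , raise-injective j (trans (sym (lookup-addEdge i j v k′)) eq)
  from : Covered v c → Covered (addEdge i j v) (punchIn j c)
  from (k , eq) = punchIn i k , trans (lookup-addEdge i j v k) (cong (raise j) eq)

covered-addLower : (j : Fin (suc m)) (v : Board N m) (c : Fin m) →
  Covered (addLower j v) (punchIn j c) ⇔ Covered v c
covered-addLower j v c = mk⇔
  (λ (k , eq) → k , raise-injective j (trans (sym (lookup-addLower j v k)) eq))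
  (λ (k , eq) → k , trans (lookup-addLower j v k) (cong (raise j) eq))

covered-addUpper : (i : Fin (suc N)) (v : Board N m) (c : Fin m) →
  Covered (addUpper i v) c ⇔ Covered v c
covered-addUpper i v c = mk⇔ to from
  where
  to : Covered (addUpper i v) c → Covered v c
  to (k , eq) with punchView i k
  ... | inj₁ refl = contradiction (trans (sym (insertAt-lookup v i nothing)) eq) λ ()
  ... | inj₂ (k′ , refl) = k′ , trans (sym (lookup-addUpper i v k′)) eq
  from : Covered v c → Covered (addUpper i v) c
  from (k , eq) = punchIn i k , trans (lookup-addUpper i v k) eq

-- The encoding already gives each upper vertex at most one edge, so only a shared lower vertex has
-- to be excluded.
Matching : Board N m → Set
Matching v = ∀ i k c → lookup v i ≡ just c → lookup v k ≡ just c → i ≡ k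

matching? : (v : Board N m) → Dec (Matching v)
matching? v = all? λ i → all? λ k → all? λ c →
  (lookup v i ≟M just c) →-dec ((lookup v k ≟M just c) →-dec (i ≟ k))

-- Old entries are raised past `j` and hence never equal `just j`, so the new edge clashes with none
-- of them.
matching-addEdge : (i : Fin (suc N)) (j : Fin (suc m)) (v : Board N m) →
  Matching (addEdge i j v) ⇔ Matching v
matching-addEdge i j v = mk⇔ to from
  where
  there : ∀ {k d} → lookup (addEdge i j v) (punchIn i k) ≡ just d → raise j (lookup v k) ≡ just d
  there {k} = trans (sym (lookup-addEdge i j v k))
  here : ∀ {d} → lookup (addEdge i j v) i ≡ just d → j ≡ d
  here eq = just-injective (trans (sym (lookup-addEdge-pivot i j v)) eq)
  to : Matching (addEdge i j v) → Matching v
  to M k l c p r = punchIn-injective i k l (M (punchIn i k) (punchIn i l) (punchIn j c)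
    (trans (lookup-addEdge i j v k) (cong (raise j) p))
    (trans (lookup-addEdge i j v l) (cong (raise j) r)))
  from : Matching v → Matching (addEdge i j v)
  from M k l d p r with punchView i k | punchView i l
  ... | inj₁ refl | inj₁ refl = refl
  ... | inj₁ refl | inj₂ (l′ , refl) with refl ← here p = contradiction (there r) (raise≢pivot j (lookup v l′))
  ... | inj₂ (k′ , refl) | inj₁ refl with refl ← here r = contradiction (there p) (raise≢pivot j (lookup v k′))
  -- A matched old entry is some `just c` raised past `j`, so `d` is `punchIn j c` and both
  -- equations pull back to `v`.
  ... | inj₂ (k′ , refl) | inj₂ (l′ , refl) with lookup v k′ in eqk | there {k′} p
  ...   | just c | refl = cong (punchIn i) (M k′ l′ c eqk (raise-injective j (there r)))

matching-addLower : (j : Fin (suc m)) (v : Board N m) → Matching (addLower j v) ⇔ Matching v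
matching-addLower j v = mk⇔ to from
  where
  there : ∀ {k d} → lookup (addLower j v) k ≡ just d → raise j (lookup v k) ≡ just d
  there {k} = trans (sym (lookup-addLower j v k))
  to : Matching (addLower j v) → Matching v
  to M k l c p r = M k l (punchIn j c)
    (trans (lookup-addLower j v k) (cong (raise j) p))
    (trans (lookup-addLower j v l) (cong (raise j) r))
  from : Matching v → Matching (addLower j v)
  from M k l d p r with lookup v k in eqk | there {k} p
  ... | just c | refl = M k l c eqk (raise-injective j (there r))

matching-addUpper : (i : Fin (suc N)) (v : Board N m) → Matching (addUpper i v) ⇔ Matching v
matching-addUpper i v = mk⇔ to from
  where
  to : Matching (addUpper i v) → Matching v
  to M k l c p r = punchIn-injective i k l (M (punchIn i k) (punchIn i l) c
    (trans (lookup-addUpper i v k) p) (trans (lookup-addUpper i v l) r))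
  absurd : ∀ {c} {A : Set} → lookup (addUpper i v) i ≡ just c → A
  absurd eq = contradiction (trans (sym (insertAt-lookup v i nothing)) eq) λ ()
  from : Matching v → Matching (addUpper i v)
  from M k l c p r with punchView i k | punchView i l
  ... | inj₁ refl | _         = absurd p
  ... | _         | inj₁ refl = absurd r
  ... | inj₂ (k′ , refl) | inj₂ (l′ , refl) = cong (punchIn i) (M k′ l′ c
    (trans (sym (lookup-addUpper i v k′)) p) (trans (sym (lookup-addUpper i v l′)) r))

-- Statistics

upperFree : Board N m → Fin N → Bool
upperFree v u = not (isJust (lookup v u))

lowerFree : Board N m → Fin m → Bool
lowerFree v c = not (does (covered? v c))

-- Block indices are shifted by one with respect to the paper: blocks are numbered from 0.
blockU : Board N m → Fin N → ℕ
blockU v i = ∑ λ u → ⟦ upperFree v u ∧ (u <F i) ⟧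

blockL : Board N m → Fin m → ℕ
blockL v j = ∑ λ c → ⟦ lowerFree v c ∧ (c <F j) ⟧

onEdge : (Fin m → ℕ) → Maybe (Fin m) → ℕ
onEdge g = maybe′ g 0

-- The number of edges and the statistics behind `bwex` and `bwt` are all instances for a suitable
-- `F` of the upper and the lower block index, so each insertion is analysed once.
edgeSum : (ℕ → ℕ → ℕ) → Board N m → ℕ
edgeSum F v = ∑ λ i → onEdge (λ j → F (blockU v i) (blockL v j)) (lookup v i)

crossing : Maybe (Fin m) → Maybe (Fin m) → Bool
crossing (just a) (just b) = b <F a
crossing _        _        = false

crossings : Board N m → ℕ
crossings v = ∑ λ i → ∑ λ k → ⟦ (i <F k) ∧ crossing (lookup v i) (lookup v k) ⟧

isJust-raise : (j : Fin (suc m)) (a : Maybe (Fin m)) → isJust (raise j a) ≡ isJust a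
isJust-raise j (just _) = refl
isJust-raise j nothing  = refl

crossing-raise : (j : Fin (suc m)) (a b : Maybe (Fin m)) →
  crossing (raise j a) (raise j b) ≡ crossing a b
crossing-raise j (just a) (just b) = punchIn-<F j b a
crossing-raise j (just _) nothing  = refl
crossing-raise j nothing  _        = refl

upperFree-addEdge : (i : Fin (suc N)) (j : Fin (suc m)) (v : Board N m) (k : Fin N) →
  upperFree (addEdge i j v) (punchIn i k) ≡ upperFree v k
upperFree-addEdge i j v k =
  cong not (trans (cong isJust (lookup-addEdge i j v k)) (isJust-raise j (lookup v k)))

upperFree-addEdge-pivot : (i : Fin (suc N)) (j : Fin (suc m)) (v : Board N m) →
  upperFree (addEdge i j v) i ≡ false
upperFree-addEdge-pivot i j v = cong (not ∘ isJust) (lookup-addEdge-pivot i j v)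

lowerFree-addEdge : (i : Fin (suc N)) (j : Fin (suc m)) (v : Board N m) (c : Fin m) →
  lowerFree (addEdge i j v) (punchIn j c) ≡ lowerFree v c
lowerFree-addEdge i j v c = cong not
  (does-⇔ (covered-addEdge i j v c) (covered? (addEdge i j v) (punchIn j c)) (covered? v c))

lowerFree-addEdge-pivot : (i : Fin (suc N)) (j : Fin (suc m)) (v : Board N m) →
  lowerFree (addEdge i j v) j ≡ false
lowerFree-addEdge-pivot i j v =
  cong not (dec-true (covered? (addEdge i j v) j) (i , lookup-addEdge-pivot i j v))

-- The new upper vertex is matched, so only old free vertices are counted. `k` is arbitrary in order
-- to cover both the old vertices and the new vertex `i`.
blockU-addEdge-any : (i : Fin (suc N)) (j : Fin (suc m)) (v : Board N m) (k : Fin (suc N)) →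
  blockU (addEdge i j v) k ≡ ∑ (λ u → ⟦ upperFree v u ∧ (punchIn i u <F k) ⟧)
blockU-addEdge-any i j v k = trans
  (∑-remove-zero i (cong (λ b → ⟦ b ∧ (i <F k) ⟧) (upperFree-addEdge-pivot i j v)))
  (∑-cong λ u → cong (λ b → ⟦ b ∧ (punchIn i u <F k) ⟧) (upperFree-addEdge i j v u))

blockL-addEdge-any : (i : Fin (suc N)) (j : Fin (suc m)) (v : Board N m) (d : Fin (suc m)) →
  blockL (addEdge i j v) d ≡ ∑ (λ c → ⟦ lowerFree v c ∧ (punchIn j c <F d) ⟧)
blockL-addEdge-any i j v d = trans
  (∑-remove-zero j (cong (λ b → ⟦ b ∧ (j <F d) ⟧) (lowerFree-addEdge-pivot i j v)))
  (∑-cong λ c → cong (λ b → ⟦ b ∧ (punchIn j c <F d) ⟧) (lowerFree-addEdge i j v c))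

blockU-addEdge : (i : Fin (suc N)) (j : Fin (suc m)) (v : Board N m) (k : Fin N) →
  blockU (addEdge i j v) (punchIn i k) ≡ blockU v k
blockU-addEdge i j v k = trans (blockU-addEdge-any i j v (punchIn i k))
  (∑-cong λ u → cong (λ b → ⟦ upperFree v u ∧ b ⟧) (punchIn-<F i u k))

blockL-addEdge : (i : Fin (suc N)) (j : Fin (suc m)) (v : Board N m) (d : Fin m) →
  blockL (addEdge i j v) (punchIn j d) ≡ blockL v d
blockL-addEdge i j v d = trans (blockL-addEdge-any i j v (punchIn j d))
  (∑-cong λ c → cong (λ b → ⟦ lowerFree v c ∧ b ⟧) (punchIn-<F j c d))

blockU-addLower : (j : Fin (suc m)) (v : Board N m) (k : Fin N) →
  blockU (addLower j v) k ≡ blockU v k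
blockU-addLower j v k = ∑-cong λ u → cong (λ b → ⟦ not b ∧ (u <F k) ⟧)
  (trans (cong isJust (lookup-addLower j v u)) (isJust-raise j (lookup v u)))

-- The new lower vertex is free, but being last it lies below no old vertex and enters no old block
-- index.
blockL-addLower-last : (v : Board N m) (d : Fin m) →
  blockL (addLower (fromℕ m) v) (punchIn (fromℕ m) d) ≡ blockL v d
blockL-addLower-last {m = m} v d = trans
  (∑-remove-zero (fromℕ m) (cong ⟦_⟧ (trans
    (cong (lowerFree (addLower (fromℕ m) v) (fromℕ m) ∧_) (last-≮ (punchIn (fromℕ m) d)))
    (∧-zeroʳ _))))
  (∑-cong λ c → cong₂ (λ a b → ⟦ not a ∧ b ⟧)
    (does-⇔ (covered-addLower (fromℕ m) v c) (covered? (addLower (fromℕ m) v) (punchIn (fromℕ m) c)) (covered? v c))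
    (punchIn-<F (fromℕ m) c d))

blockU-addUpper-last : (v : Board N m) (k : Fin N) →
  blockU (addUpper (fromℕ N) v) (punchIn (fromℕ N) k) ≡ blockU v k
blockU-addUpper-last {N} v k = trans
  (∑-remove-zero (fromℕ N) (cong ⟦_⟧ (trans
    (cong (upperFree (addUpper (fromℕ N) v) (fromℕ N) ∧_) (last-≮ (punchIn (fromℕ N) k)))
    (∧-zeroʳ _))))
  (∑-cong λ u → cong₂ (λ a b → ⟦ not (isJust a) ∧ b ⟧)
    (lookup-addUpper (fromℕ N) v u) (punchIn-<F (fromℕ N) u k))

blockL-addUpper : (i : Fin (suc N)) (v : Board N m) (d : Fin m) →
  blockL (addUpper i v) d ≡ blockL v d
blockL-addUpper i v d = ∑-cong λ c → cong (λ b → ⟦ not b ∧ (c <F d) ⟧)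
  (does-⇔ (covered-addUpper i v c) (covered? (addUpper i v) c) (covered? v c))

onEdge-raise : (j : Fin (suc m)) {g : Fin (suc m) → ℕ} {h : Fin m → ℕ} →
  (∀ c → g (punchIn j c) ≡ h c) → (a : Maybe (Fin m)) → onEdge g (raise j a) ≡ onEdge h a
onEdge-raise j eq (just c) = eq c
onEdge-raise j eq nothing  = refl

onEdge-cong : {g h : Fin m → ℕ} → (∀ c → g c ≡ h c) → (a : Maybe (Fin m)) → onEdge g a ≡ onEdge h a
onEdge-cong eq (just c) = eq c
onEdge-cong eq nothing  = refl

-- Both new vertices are matched, so no old block index moves and the only change is the term of the
-- new edge.
edgeSum-addEdge : ∀ F (i : Fin (suc N)) (j : Fin (suc m)) (v : Board N m) →
  edgeSum F (addEdge i j v) ≡ F (blockU (addEdge i j v) i) (blockL (addEdge i j v) j) +ℕ edgeSum F v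
edgeSum-addEdge F i j v = trans (∑-remove i) (cong₂ _+ℕ_
  (cong (onEdge _) (lookup-addEdge-pivot i j v))
  (∑-cong λ k → trans (cong (onEdge _) (lookup-addEdge i j v k))
    (onEdge-raise j (λ c → cong₂ F (blockU-addEdge i j v k) (blockL-addEdge i j v c)) (lookup v k))))

edgeSum-addLower-last : ∀ F (v : Board N m) → edgeSum F (addLower (fromℕ m) v) ≡ edgeSum F v
edgeSum-addLower-last {m = m} F v = ∑-cong λ k →
  trans (cong (onEdge _) (lookup-addLower (fromℕ m) v k))
    (onEdge-raise (fromℕ m)
      (λ c → cong₂ F (blockU-addLower (fromℕ m) v k) (blockL-addLower-last v c)) (lookup v k))

edgeSum-addUpper-last : ∀ F (v : Board N m) → edgeSum F (addUpper (fromℕ N) v) ≡ edgeSum F v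
edgeSum-addUpper-last {N} F v = trans
  (∑-remove-zero (fromℕ N) (cong (onEdge _) (insertAt-lookup v (fromℕ N) nothing)))
  (∑-cong λ k → trans (cong (onEdge _) (lookup-addUpper (fromℕ N) v k))
    (onEdge-cong (λ c → cong₂ F (blockU-addUpper-last v k) (blockL-addUpper (fromℕ N) v c)) (lookup v k)))

crossings-addLower : (j : Fin (suc m)) (v : Board N m) → crossings (addLower j v) ≡ crossings v
crossings-addLower j v = ∑-cong λ i → ∑-cong λ k → cong (λ b → ⟦ (i <F k) ∧ b ⟧)
  (trans (cong₂ crossing (lookup-addLower j v i) (lookup-addLower j v k))
    (crossing-raise j (lookup v i) (lookup v k)))

crossing-nothingʳ : (a : Maybe (Fin m)) → crossing a nothing ≡ false
crossing-nothingʳ (just _) = refl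
crossing-nothingʳ nothing  = refl

crossings-addUpper : (i : Fin (suc N)) (v : Board N m) → crossings (addUpper i v) ≡ crossings v
crossings-addUpper i v = trans
  (∑-remove-zero i (∑-zero λ k → cong ⟦_⟧ (trans
    (cong (λ a → (i <F k) ∧ crossing a (lookup (addUpper i v) k)) (insertAt-lookup v i nothing))
    (∧-zeroʳ (i <F k)))))
  (∑-cong λ l → trans
    (∑-remove-zero i (cong ⟦_⟧ (trans
      (cong ((punchIn i l <F i) ∧_) (trans
        (cong (crossing (lookup (addUpper i v) (punchIn i l))) (insertAt-lookup v i nothing))
        (crossing-nothingʳ (lookup (addUpper i v) (punchIn i l)))))
      (∧-zeroʳ (punchIn i l <F i)))))
    (∑-cong λ k → cong₂ (λ a b → ⟦ a ∧ b ⟧) (punchIn-<F i l k)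
      (cong₂ crossing (lookup-addUpper i v l) (lookup-addUpper i v k))))

-- Pairs split into those where the new edge comes first, those where it comes second, and old
-- pairs, whose order is kept by `punchIn` on both sides.
crossings-addEdge : (i : Fin (suc N)) (j : Fin (suc m)) (v : Board N m) →
  crossings (addEdge i j v) ≡
    ∑ (λ k → ⟦ (i <F punchIn i k) ∧ crossing (just j) (raise j (lookup v k)) ⟧) +ℕ
    (∑ (λ k → ⟦ (punchIn i k <F i) ∧ crossing (raise j (lookup v k)) (just j) ⟧) +ℕ crossings v)
crossings-addEdge i j v = trans (∑-remove i) (cong₂ _+ℕ_
  (trans
    -- The pair of the new edge with itself drops out because `i <F i` is false.
    (∑-remove-zero i (cong ⟦_⟧ (trans
      (cong ((i <F i) ∧_) (cong₂ crossing pivot pivot))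
      (irrefl i))))
    (∑-cong λ k → cong (λ b → ⟦ (i <F punchIn i k) ∧ b ⟧)
      (cong₂ crossing pivot (lookup-addEdge i j v k))))
  (trans
    (∑-cong λ l → trans (∑-remove i) (cong₂ _+ℕ_
      (cong (λ b → ⟦ (punchIn i l <F i) ∧ b ⟧) (cong₂ crossing (lookup-addEdge i j v l) pivot))
      (∑-cong λ k → cong₂ (λ a b → ⟦ a ∧ b ⟧) (punchIn-<F i l k)
        (trans (cong₂ crossing (lookup-addEdge i j v l) (lookup-addEdge i j v k))
          (crossing-raise j (lookup v l) (lookup v k))))))
    (∑-distrib-+)))
  where
  pivot = lookup-addEdge-pivot i j v
  irrefl : (k : Fin (suc n)) {b : Bool} → (k <F k) ∧ b ≡ false
  irrefl zero = refl
  irrefl {suc n} (suc k) = irrefl k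

-- Spreads the value at one entry over all lower vertices, so that a sum over edges can be exchanged
-- with a sum over lower vertices.
onEdge-∑ : (r : Fin m → Bool) (a : Maybe (Fin m)) →
  onEdge (⟦_⟧ ∘ r) a ≡ ∑ (λ c → ⟦ does (a ≟M just c) ∧ r c ⟧)
onEdge-∑ r nothing  = sym (∑-zero λ c → refl)
onEdge-∑ {suc m} r (just d) = sym (trans (∑-remove d) (trans
  (cong₂ _+ℕ_
    (cong (λ b → ⟦ b ∧ r d ⟧) (dec-true (just d ≟M just d) refl))
    (∑-zero λ c → cong (λ b → ⟦ b ∧ r (punchIn d c) ⟧)
      (dec-false (just d ≟M just (punchIn d c)) λ eq → punchInᵢ≢i d c (sym (just-injective eq)))))
  (ℕₚ.+-identityʳ ⟦ r d ⟧)))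

∑-∧ʳ : {p : Fin n → Bool} {a : Bool} (b : Bool) →
  ∑ (λ k → ⟦ p k ⟧) ≡ ⟦ a ⟧ → ∑ (λ k → ⟦ p k ∧ b ⟧) ≡ ⟦ a ∧ b ⟧
∑-∧ʳ {p = p} {a} true  eq =
  trans (∑-cong λ k → cong ⟦_⟧ (∧-identityʳ (p k))) (trans eq (cong ⟦_⟧ (sym (∧-identityʳ a))))
∑-∧ʳ {p = p} {a} false eq =
  trans (∑-zero λ k → cong ⟦_⟧ (∧-zeroʳ (p k))) (cong ⟦_⟧ (sym (∧-zeroʳ a)))

complement : ∀ a b → ⟦ not a ∧ b ⟧ +ℕ ⟦ a ∧ b ⟧ ≡ ⟦ b ⟧
complement true  b = refl
complement false b = ℕₚ.+-identityʳ ⟦ b ⟧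

-- In a matching, summing over the edges amounts to summing over the covered lower vertices.
lower-partition : (v : Board N m) → Matching v → (r : Fin m → Bool) →
  ∑ (λ c → ⟦ lowerFree v c ∧ r c ⟧) +ℕ ∑ (λ k → onEdge (⟦_⟧ ∘ r) (lookup v k)) ≡ ∑ (λ c → ⟦ r c ⟧)
lower-partition v M r = begin
  ∑ (λ c → ⟦ lowerFree v c ∧ r c ⟧) +ℕ ∑ (λ k → onEdge (⟦_⟧ ∘ r) (lookup v k))
    ≡⟨ cong (∑ (λ c → ⟦ lowerFree v c ∧ r c ⟧) +ℕ_) (trans (∑-cong λ k → onEdge-∑ r (lookup v k)) ∑-comm) ⟩
  ∑ (λ c → ⟦ lowerFree v c ∧ r c ⟧) +ℕ ∑ (λ c → ∑ (λ k → ⟦ does (lookup v k ≟M just c) ∧ r c ⟧))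
    ≡⟨ cong (∑ (λ c → ⟦ lowerFree v c ∧ r c ⟧) +ℕ_) (∑-cong λ c → ∑-∧ʳ (r c)
         (∑-unique (λ k → lookup v k ≟M just c) λ {i} {k} → M i k c)) ⟩
  ∑ (λ c → ⟦ lowerFree v c ∧ r c ⟧) +ℕ ∑ (λ c → ⟦ does (covered? v c) ∧ r c ⟧)
    ≡⟨ ∑-distrib-+ ⟨
  ∑ (λ c → ⟦ lowerFree v c ∧ r c ⟧ +ℕ ⟦ does (covered? v c) ∧ r c ⟧)
    ≡⟨ ∑-cong (λ c → complement (does (covered? v c)) (r c)) ⟩
  ∑ (λ c → ⟦ r c ⟧) ∎
  where open ≡-Reasoning

upper-partition : (v : Board N m) (r : Fin N → Bool) →
  ∑ (λ k → ⟦ upperFree v k ∧ r k ⟧) +ℕ ∑ (λ k → ⟦ isJust (lookup v k) ∧ r k ⟧) ≡ ∑ (λ k → ⟦ r k ⟧)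
upper-partition v r =
  trans (sym ∑-distrib-+) (∑-cong λ k → complement (isJust (lookup v k)) (r k))

edgeSum-[] : ∀ F → edgeSum {0} {m} F [] ≡ 0
edgeSum-[] F = ∑-empty

edgeCount : Board N m → ℕ
edgeCount = edgeSum λ _ _ → 1

∑-∧-true : (p : Fin n → Bool) → ∑ (λ i → ⟦ p i ∧ true ⟧) ≡ ∑ (λ i → ⟦ p i ⟧)
∑-∧-true p = ∑-cong λ i → cong ⟦_⟧ (∧-identityʳ (p i))

-- Together with `upperFree-count` this fixes the surplus of free upper over free lower vertices:
-- zero on a square board, one if there is one more upper vertex. The surplus decides the sign of
-- the block difference of an edge at the last vertex.
lowerFree-count : (v : Board N m) → Matching v → ∑ (λ c → ⟦ lowerFree v c ⟧) +ℕ edgeCount v ≡ m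
lowerFree-count {m = m} v M = trans
  (cong (_+ℕ edgeCount v) (sym (∑-∧-true (lowerFree v))))
  (trans (lower-partition v M (λ _ → true)) (∑-one m))

upperFree-count : (v : Board N m) → ∑ (λ k → ⟦ upperFree v k ⟧) +ℕ edgeCount v ≡ N
upperFree-count {N} v = trans (sym ∑-distrib-+) (trans (∑-cong λ k → pointwise (lookup v k)) (∑-one N))
  where
  pointwise : (a : Maybe (Fin m)) → ⟦ not (isJust a) ⟧ +ℕ onEdge (λ _ → 1) a ≡ 1
  pointwise (just _) = refl
  pointwise nothing  = refl

edgeCount≤ : (v : Board N m) → edgeCount v ≤ N
edgeCount≤ v = subst (edgeCount v ≤_) (upperFree-count v) (ℕₚ.m≤n+m (edgeCount v) _)

nonnegTerm : ℕ → ℕ → ℕ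
nonnegTerm a b = ⟦ not (b <ᵇ a) ⟧

-- `a` is the upper and `b` the lower block index. The guard makes the truncated subtractions exact:
-- `b` is at least `a` in the first branch, and `a` exceeds `b` in the second.
diffTerm : ℕ → ℕ → ℕ
diffTerm a b = if not (b <ᵇ a) then b ∸ a else (a ∸ b) ∸ 1

nonnegCount : Board N m → ℕ
nonnegCount = edgeSum nonnegTerm

qExponent : Board N m → ℕ
qExponent v = edgeSum diffTerm v +ℕ crossings v

+-≮ᵇ : ∀ a b → (a +ℕ b <ᵇ b) ≡ false
+-≮ᵇ a b = dec-false (a +ℕ b ℕₚ.<? b) (ℕₚ.≤⇒≯ (ℕₚ.m≤n+m b a))

+-<ᵇ-suc : ∀ a b → (b <ᵇ suc (a +ℕ b)) ≡ true
+-<ᵇ-suc a b = dec-true (b ℕₚ.<? suc (a +ℕ b)) (s≤s (ℕₚ.m≤n+m b a))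

nonnegTerm-nonneg : ∀ a b → nonnegTerm b (a +ℕ b) ≡ 1
nonnegTerm-nonneg a b rewrite +-≮ᵇ a b = refl

diffTerm-nonneg : ∀ a b → diffTerm b (a +ℕ b) ≡ a
diffTerm-nonneg a b rewrite +-≮ᵇ a b = ℕₚ.m+n∸n≡m a b

nonnegTerm-neg : ∀ a b → nonnegTerm (suc (a +ℕ b)) b ≡ 0
nonnegTerm-neg a b rewrite +-<ᵇ-suc a b = refl

-- The final `∸ 1` absorbs the successor, so an excess of `a + 1` on the upper side contributes `a`,
-- just like an excess of `a` on the lower side.
diffTerm-neg : ∀ a b → diffTerm (suc (a +ℕ b)) b ≡ a
diffTerm-neg a b rewrite +-<ᵇ-suc a b = cong (_∸ 1) (ℕₚ.m+n∸n≡m (suc a) b)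

-- Statistics of an edge inserted at the last lower or the last upper vertex.

module LastLower (i : Fin (suc n)) (v : Board n n) (M : Matching v) where
  private
    V = addEdge i (fromℕ n) v
    freeAbove = ∑ λ u → ⟦ upperFree v u ∧ (i <F punchIn i u) ⟧
    gained = ∑ λ k → ⟦ isJust (lookup v k) ∧ (i <F punchIn i k) ⟧

  -- All free lower vertices lie below the last one, and they are as many as the free upper
  -- vertices, which lie either above `i` or in the block count of `i`. The block difference is thus
  -- `freeAbove`.
  blocks : blockL V (fromℕ n) ≡ freeAbove +ℕ blockU V i
  blocks = begin
    blockL V (fromℕ n)
      ≡⟨ blockL-addEdge-any i (fromℕ n) v (fromℕ n) ⟩
    ∑ (λ c → ⟦ lowerFree v c ∧ (punchIn (fromℕ n) c <F fromℕ n) ⟧)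
      ≡⟨ ∑-cong (λ c → cong ⟦_⟧ (trans (cong (lowerFree v c ∧_) (punchIn-<F-last c)) (∧-identityʳ _))) ⟩
    ∑ (λ c → ⟦ lowerFree v c ⟧)
      ≡⟨ ℕₚ.+-cancelʳ-≡ (edgeCount v) _ _ (trans (lowerFree-count v M) (sym (upperFree-count v))) ⟩
    ∑ (λ u → ⟦ upperFree v u ⟧)
      ≡⟨ ∑-split (upperFree v) (λ u → i <F punchIn i u) ⟨
    freeAbove +ℕ ∑ (λ u → ⟦ upperFree v u ∧ not (i <F punchIn i u) ⟧)
      ≡⟨ cong (freeAbove +ℕ_) (∑-cong λ u → cong (λ b → ⟦ upperFree v u ∧ b ⟧) (punchIn-<F-pivot i u)) ⟨
    freeAbove +ℕ ∑ (λ u → ⟦ upperFree v u ∧ (punchIn i u <F i) ⟧)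
      ≡⟨ cong (freeAbove +ℕ_) (blockU-addEdge-any i (fromℕ n) v i) ⟨
    freeAbove +ℕ blockU V i ∎
    where open ≡-Reasoning

  nonnegCount-add : nonnegCount V ≡ suc (nonnegCount v)
  nonnegCount-add = trans (edgeSum-addEdge nonnegTerm i (fromℕ n) v) (cong (_+ℕ nonnegCount v)
    (trans (cong (nonnegTerm (blockU V i)) blocks) (nonnegTerm-nonneg freeAbove (blockU V i))))

  -- The new edge has the largest lower end, so it crosses exactly the edges whose upper end lies
  -- above `i`.
  crossings-add : crossings V ≡ gained +ℕ crossings v
  crossings-add = trans (crossings-addEdge i (fromℕ n) v) (cong₂ _+ℕ_
    (∑-cong λ k → cong ⟦_⟧ (trans
      (cong ((i <F punchIn i k) ∧_) (crosses (lookup v k)))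
      (∧-comm (i <F punchIn i k) _)))
    (cong (_+ℕ crossings v) (∑-zero λ k → cong ⟦_⟧ (trans
      (cong ((punchIn i k <F i) ∧_) (never-crosses (lookup v k)))
      (∧-zeroʳ (punchIn i k <F i))))))
    where
    crosses : (a : Maybe (Fin n)) → crossing (just (fromℕ n)) (raise (fromℕ n) a) ≡ isJust a
    crosses (just c) = punchIn-<F-last c
    crosses nothing  = refl
    never-crosses : (a : Maybe (Fin n)) → crossing (raise (fromℕ n) a) (just (fromℕ n)) ≡ false
    never-crosses (just c) = last-≮ (punchIn (fromℕ n) c)
    never-crosses nothing  = refl

  -- Free upper vertices above `i` enter through the block difference and matched ones through
  -- crossings. The gain depends on `i` alone, which lets the weight of `v` factor out.
  qExponent-add : qExponent V ≡ toℕ (opposite i) +ℕ qExponent v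
  qExponent-add = begin
    edgeSum diffTerm V +ℕ crossings V
      ≡⟨ cong₂ _+ℕ_ (edgeSum-addEdge diffTerm i (fromℕ n) v) crossings-add ⟩
    (diffTerm (blockU V i) (blockL V (fromℕ n)) +ℕ edgeSum diffTerm v) +ℕ (gained +ℕ crossings v)
      ≡⟨ cong (λ t → (t +ℕ edgeSum diffTerm v) +ℕ (gained +ℕ crossings v))
           (trans (cong (diffTerm (blockU V i)) blocks) (diffTerm-nonneg freeAbove (blockU V i))) ⟩
    (freeAbove +ℕ edgeSum diffTerm v) +ℕ (gained +ℕ crossings v)
      ≡⟨ interchange freeAbove _ _ _ ⟩
    (freeAbove +ℕ gained) +ℕ qExponent v
      ≡⟨ cong (_+ℕ qExponent v) (trans (upper-partition v (λ k → i <F punchIn i k)) (∑-above-pivot i)) ⟩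
    toℕ (opposite i) +ℕ qExponent v ∎
    where open ≡-Reasoning

module LastUpper (j : Fin (suc m)) (v : Board (suc m) m) (M : Matching v) where
  private
    last = fromℕ (suc m)
    V = addEdge last j v
    freeAbove = ∑ λ c → ⟦ lowerFree v c ∧ (j <F punchIn j c) ⟧
    gained = ∑ λ k → onEdge (λ c → ⟦ j <F punchIn j c ⟧) (lookup v k)

  -- Now all free upper vertices lie below the last one, and the block difference is
  -- `- freeAbove - 1`.
  blocks : blockU V last ≡ suc (freeAbove +ℕ blockL V j)
  blocks = begin
    blockU V last
      ≡⟨ blockU-addEdge-any last j v last ⟩
    ∑ (λ u → ⟦ upperFree v u ∧ (punchIn last u <F last) ⟧)
      ≡⟨ ∑-cong (λ u → cong ⟦_⟧ (trans (cong (upperFree v u ∧_) (punchIn-<F-last u)) (∧-identityʳ _))) ⟩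
    ∑ (λ u → ⟦ upperFree v u ⟧)
      -- The successor is the one surplus free upper vertex of a board with `m + 1` upper and `m`
      -- lower vertices.
      ≡⟨ ℕₚ.+-cancelʳ-≡ (edgeCount v) _ _ (trans (upperFree-count v) (cong suc (sym (lowerFree-count v M)))) ⟩
    suc (∑ (λ c → ⟦ lowerFree v c ⟧))
      ≡⟨ cong suc (∑-split (lowerFree v) (λ c → j <F punchIn j c)) ⟨
    suc (freeAbove +ℕ ∑ (λ c → ⟦ lowerFree v c ∧ not (j <F punchIn j c) ⟧))
      ≡⟨ cong (λ t → suc (freeAbove +ℕ t)) (∑-cong λ c → cong (λ b → ⟦ lowerFree v c ∧ b ⟧) (punchIn-<F-pivot j c)) ⟨
    suc (freeAbove +ℕ ∑ (λ c → ⟦ lowerFree v c ∧ (punchIn j c <F j) ⟧))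
      ≡⟨ cong (λ t → suc (freeAbove +ℕ t)) (blockL-addEdge-any last j v j) ⟨
    suc (freeAbove +ℕ blockL V j) ∎
    where open ≡-Reasoning

  nonnegCount-add : nonnegCount V ≡ nonnegCount v
  nonnegCount-add = trans (edgeSum-addEdge nonnegTerm last j v) (cong (_+ℕ nonnegCount v)
    (trans (cong (λ t → nonnegTerm t (blockL V j)) blocks) (nonnegTerm-neg freeAbove (blockL V j))))

  -- The new edge has the largest upper end, so it is second in every pair and crosses the edges
  -- whose lower end lies above `j`.
  crossings-add : crossings V ≡ gained +ℕ crossings v
  crossings-add = trans (crossings-addEdge last j v) (cong₂ _+ℕ_
    (∑-zero λ k →
      cong (λ b → ⟦ b ∧ crossing (just j) (raise j (lookup v k)) ⟧) (last-≮ (punchIn last k)))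
    (cong (_+ℕ crossings v) (∑-cong λ k → trans
      (cong (λ b → ⟦ b ∧ crossing (raise j (lookup v k)) (just j) ⟧) (punchIn-<F-last k))
      (crosses (lookup v k)))))
    where
    crosses : (a : Maybe (Fin m)) →
      ⟦ crossing (raise j a) (just j) ⟧ ≡ onEdge (λ c → ⟦ j <F punchIn j c ⟧) a
    crosses (just c) = refl
    crosses nothing  = refl

  qExponent-add : qExponent V ≡ toℕ (opposite j) +ℕ qExponent v
  qExponent-add = begin
    edgeSum diffTerm V +ℕ crossings V
      ≡⟨ cong₂ _+ℕ_ (edgeSum-addEdge diffTerm last j v) crossings-add ⟩
    (diffTerm (blockU V last) (blockL V j) +ℕ edgeSum diffTerm v) +ℕ (gained +ℕ crossings v)
      ≡⟨ cong (λ t → (t +ℕ edgeSum diffTerm v) +ℕ (gained +ℕ crossings v))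
           (trans (cong (λ t → diffTerm t (blockL V j)) blocks) (diffTerm-neg freeAbove (blockL V j))) ⟩
    (freeAbove +ℕ edgeSum diffTerm v) +ℕ (gained +ℕ crossings v)
      ≡⟨ interchange freeAbove _ _ _ ⟩
    (freeAbove +ℕ gained) +ℕ qExponent v
      -- `gained` is indexed by upper vertices; the partition reindexes it by covered lower
      -- vertices, which complement `freeAbove`.
      ≡⟨ cong (_+ℕ qExponent v) (trans (lower-partition v M (λ c → j <F punchIn j c)) (∑-above-pivot j)) ⟩
    toℕ (opposite j) +ℕ qExponent v ∎
    where open ≡-Reasoning

-- Sums over boards

module BoardSum {c ℓ} (R : CommutativeRing c ℓ) where
  open CommutativeRing R
    hiding (zero) renaming (refl to ≈-refl; sym to ≈-sym; trans to ≈-trans)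
  open FinSum +-commutativeMonoid using () renaming
    ( ∑ to ∑ᴿ; ∑-empty to ∑ᴿ-empty; ∑-suc to ∑ᴿ-suc; ∑-cong to ∑ᴿ-cong; ∑-remove to ∑ᴿ-remove
    ; ∑-distrib-+ to ∑ᴿ-distrib-+; ∑-comm to ∑ᴿ-comm; ∑-zero to ∑ᴿ-zero; ∑-opposite to ∑ᴿ-opposite) public
  open import Algebra.Properties.CommutativeSemigroup +-commutativeSemigroup
    using (x∙yz≈y∙xz) renaming (interchange to +-interchange)
  open import Relation.Binary.Reasoning.Setoid setoid

  ∑ᴿ-distribʳ : (f : Fin n → Carrier) (a : Carrier) → ∑ᴿ (λ i → f i * a) ≈ ∑ᴿ f * a
  ∑ᴿ-distribʳ {zero}  f a = ≈-trans ∑ᴿ-empty (≈-sym (≈-trans (*-congʳ ∑ᴿ-empty) (zeroˡ a)))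
  ∑ᴿ-distribʳ {suc n} f a = begin
    ∑ᴿ (λ i → f i * a)                     ≈⟨ ∑ᴿ-suc _ ⟩
    f zero * a + ∑ᴿ (λ i → f (suc i) * a)  ≈⟨ +-congˡ (∑ᴿ-distribʳ (f ∘ suc) a) ⟩
    f zero * a + ∑ᴿ (f ∘ suc) * a          ≈⟨ distribʳ a _ _ ⟨
    (f zero + ∑ᴿ (f ∘ suc)) * a            ≈⟨ *-congʳ (∑ᴿ-suc f) ⟨
    ∑ᴿ f * a                               ∎

  ∑ᴿ-distribˡ : (f : Fin n → Carrier) (a : Carrier) → ∑ᴿ (λ i → a * f i) ≈ a * ∑ᴿ f
  ∑ᴿ-distribˡ f a = begin
    ∑ᴿ (λ i → a * f i)  ≈⟨ ∑ᴿ-cong (λ i → *-comm a (f i)) ⟩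
    ∑ᴿ (λ i → f i * a)  ≈⟨ ∑ᴿ-distribʳ f a ⟩
    ∑ᴿ f * a            ≈⟨ *-comm _ a ⟩
    a * ∑ᴿ f            ∎

  opaque
    ∑M : (Maybe (Fin m) → Carrier) → Carrier
    ∑M g = g nothing + ∑ᴿ (g ∘ just)

    ∑M-unfold : {f : Maybe (Fin m) → Carrier} → ∑M f ≈ f nothing + ∑ᴿ (f ∘ just)
    ∑M-unfold = ≈-refl

    ∑M-cong : {f g : Maybe (Fin m) → Carrier} → (∀ a → f a ≈ g a) → ∑M f ≈ ∑M g
    ∑M-cong eq = +-cong (eq nothing) (∑ᴿ-cong (eq ∘ just))

    ∑M-zero : {f : Maybe (Fin m) → Carrier} → (∀ a → f a ≈ 0#) → ∑M f ≈ 0#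
    ∑M-zero f≈0 = ≈-trans (+-cong (f≈0 nothing) (∑ᴿ-zero (f≈0 ∘ just))) (+-identityˡ 0#)

    ∑M-distribˡ : {f : Maybe (Fin m) → Carrier} (a : Carrier) → ∑M (λ b → a * f b) ≈ a * ∑M f
    ∑M-distribˡ {f = f} a = ≈-trans (+-congˡ (∑ᴿ-distribˡ (f ∘ just) a)) (≈-sym (distribˡ a _ _))

    ∑M-distrib-+ : {f g : Maybe (Fin m) → Carrier} → ∑M (λ a → f a + g a) ≈ ∑M f + ∑M g
    ∑M-distrib-+ = ≈-trans (+-congˡ ∑ᴿ-distrib-+) (+-interchange _ _ _ _)

    ∑M-∑ᴿ-comm : {f : Maybe (Fin m) → Fin n → Carrier} →
      ∑M (λ a → ∑ᴿ (f a)) ≈ ∑ᴿ (λ j → ∑M (λ a → f a j))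
    ∑M-∑ᴿ-comm = ≈-trans (+-congˡ ∑ᴿ-comm) (≈-sym ∑ᴿ-distrib-+)

    ∑M-comm : {f : Maybe (Fin m) → Maybe (Fin n) → Carrier} →
      ∑M (λ a → ∑M (f a)) ≈ ∑M (λ b → ∑M (λ a → f a b))
    ∑M-comm {f = f} = ≈-trans
      (∑M-distrib-+ {f = λ a → f a nothing} {g = λ a → ∑ᴿ (f a ∘ just)})
      (+-congˡ (∑M-∑ᴿ-comm {f = λ a → f a ∘ just}))

    -- The entries other than `just j` are exactly the raised ones.
    ∑M-raise : (j : Fin (suc m)) {f : Maybe (Fin (suc m)) → Carrier} →
      ∑M f ≈ f (just j) + ∑M (f ∘ raise j)
    ∑M-raise j = ≈-trans (+-congˡ (∑ᴿ-remove j)) (x∙yz≈y∙xz _ _ _)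

  -- Runs over all boards, so that it is an iterated sum over entries; boards that are not matchings
  -- are given the summand zero later.
  ∑B : ∀ N → (Board N m → Carrier) → Carrier
  ∑B zero    f = f []
  ∑B (suc N) f = ∑M λ a → ∑B N λ v → f (a ∷ v)

  ∑B-cong : ∀ N {f g : Board N m → Carrier} → (∀ v → f v ≈ g v) → ∑B N f ≈ ∑B N g
  ∑B-cong zero    eq = eq []
  ∑B-cong (suc N) eq = ∑M-cong λ a → ∑B-cong N λ v → eq (a ∷ v)

  ∑B-zero : ∀ N {f : Board N m → Carrier} → (∀ v → f v ≈ 0#) → ∑B N f ≈ 0#
  ∑B-zero zero    f≈0 = f≈0 []
  ∑B-zero (suc N) f≈0 = ∑M-zero λ a → ∑B-zero N λ v → f≈0 (a ∷ v)

  ∑B-distribˡ : ∀ N (f : Board N m → Carrier) (a : Carrier) → ∑B N (λ v → a * f v) ≈ a * ∑B N f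
  ∑B-distribˡ zero    f a = ≈-refl
  ∑B-distribˡ (suc N) f a =
    ≈-trans (∑M-cong λ b → ∑B-distribˡ N (λ v → f (b ∷ v)) a) (∑M-distribˡ a)

  -- The sum over entry `i` is moved outermost by exchanging it with the sums over the entries
  -- before it.
  ∑B-insertAt : ∀ N (i : Fin (suc N)) (f : Board (suc N) m → Carrier) →
    ∑B (suc N) f ≈ ∑M (λ a → ∑B N (λ v → f (insertAt v i a)))
  ∑B-insertAt N       zero    f = ≈-refl
  ∑B-insertAt (suc N) (suc i) f =
    ≈-trans (∑M-cong λ b → ∑B-insertAt N i (λ v → f (b ∷ v))) ∑M-comm

  ∑B-avoid : ∀ N (j : Fin (suc m)) (f : Board N (suc m) → Carrier) →
    (∀ v k → lookup v k ≡ just j → f v ≈ 0#) → ∑B N f ≈ ∑B N (f ∘ addLower j)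
  ∑B-avoid zero    j f vanish = ≈-refl
  ∑B-avoid (suc N) j f vanish = begin
    ∑M (λ a → ∑B N (λ v → f (a ∷ v)))
      ≈⟨ ∑M-raise j ⟩
    ∑B N (λ v → f (just j ∷ v)) + ∑M (λ a → ∑B N (λ v → f (raise j a ∷ v)))
      ≈⟨ +-cong (∑B-zero N λ v → vanish (just j ∷ v) zero refl)
           (∑M-cong λ a → ∑B-avoid N j (λ v → f (raise j a ∷ v)) λ v k → vanish (raise j a ∷ v) (suc k)) ⟩
    0# + ∑B (suc N) (f ∘ addLower j)
      ≈⟨ +-identityˡ _ ⟩
    ∑B (suc N) (f ∘ addLower j) ∎

  -- Boards where `j` lies on exactly one edge, indexed by its upper end. The split on `N` reflects
  -- that `addEdge` always produces an upper vertex.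
  ∑Edge : ∀ N → Fin (suc m) → (Board N (suc m) → Carrier) → Carrier
  ∑Edge zero    j f = 0#
  ∑Edge (suc N) j f = ∑ᴿ λ i → ∑B N (f ∘ addEdge i j)

  ∑Edge-suc : ∀ N (j : Fin (suc m)) (f : Board (suc N) (suc m) → Carrier) →
    ∑Edge (suc N) j f ≈
      ∑B N (λ v → f (just j ∷ addLower j v)) + ∑M (λ a → ∑Edge N j (λ v → f (raise j a ∷ v)))
  ∑Edge-suc zero    j f = ≈-trans (∑ᴿ-suc _) (+-congˡ (≈-trans ∑ᴿ-empty (≈-sym (∑M-zero λ a → ≈-refl))))
  ∑Edge-suc (suc N) j f = ≈-trans (∑ᴿ-suc _) (+-congˡ (≈-sym ∑M-∑ᴿ-comm))

  -- Induction on the upper vertices: if the first is joined to `j`, all others avoid `j`; otherwise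
  -- the question passes to the rest of the board.
  ∑B-once : ∀ N (j : Fin (suc m)) (f : Board N (suc m) → Carrier) →
    (∀ v k l → ¬ k ≡ l → lookup v k ≡ just j → lookup v l ≡ just j → f v ≈ 0#) →
    ∑B N f ≈ ∑B N (f ∘ addLower j) + ∑Edge N j f
  ∑B-once zero    j f vanish = ≈-sym (+-identityʳ _)
  ∑B-once (suc N) j f vanish = begin
    ∑M (λ a → ∑B N (λ v → f (a ∷ v)))
      ≈⟨ ∑M-raise j ⟩
    ∑B N (λ v → f (just j ∷ v)) + ∑M (λ a → ∑B N (λ v → f (raise j a ∷ v)))
      ≈⟨ +-cong
           (∑B-avoid N j _ λ v k → vanish (just j ∷ v) zero (suc k) (λ ()) refl)
           (≈-trans
             (∑M-cong λ a → ∑B-once N j (λ v → f (raise j a ∷ v)) λ v k l k≢l →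
               vanish (raise j a ∷ v) (suc k) (suc l) (k≢l ∘ suc-injective))
             ∑M-distrib-+) ⟩
    ∑B N (λ v → f (just j ∷ addLower j v)) +
      (∑B (suc N) (f ∘ addLower j) + ∑M (λ a → ∑Edge N j (λ v → f (raise j a ∷ v))))
      ≈⟨ x∙yz≈y∙xz _ _ _ ⟩
    ∑B (suc N) (f ∘ addLower j) +
      (∑B N (λ v → f (just j ∷ addLower j v)) + ∑M (λ a → ∑Edge N j (λ v → f (raise j a ∷ v))))
      ≈⟨ +-congˡ (∑Edge-suc N j f) ⟨
    ∑B (suc N) (f ∘ addLower j) + ∑Edge (suc N) j f ∎

  sumR-++ : ∀ as bs → sumR R (as ++ bs) ≈ sumR R as + sumR R bs
  sumR-++ []       bs = ≈-sym (+-identityˡ _)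
  sumR-++ (a ∷ as) bs = ≈-trans (+-congˡ (sumR-++ as bs)) (≈-sym (+-assoc a _ _))

  sumR-concatMap : ∀ {a b} {A : Set a} {B : Set b} (g : B → Carrier) (h : A → List B) as →
    sumR R (List.map g (concatMap h as)) ≈ sumR R (List.map (λ a → sumR R (List.map g (h a))) as)
  sumR-concatMap g h []       = ≈-refl
  sumR-concatMap g h (a ∷ as) = begin
    sumR R (List.map g (h a ++ concatMap h as))
      ≈⟨ reflexive (cong (sumR R) (map-++ g (h a) (concatMap h as))) ⟩
    sumR R (List.map g (h a) ++ List.map g (concatMap h as))
      ≈⟨ sumR-++ (List.map g (h a)) _ ⟩
    sumR R (List.map g (h a)) + sumR R (List.map g (concatMap h as))
      ≈⟨ +-congˡ (sumR-concatMap g h as) ⟩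
    sumR R (List.map (λ a → sumR R (List.map g (h a))) (a ∷ as)) ∎

  sumR-tabulate : (f : Fin n → Carrier) → sumR R (List.tabulate f) ≈ ∑ᴿ f
  sumR-tabulate {zero}  f = ≈-sym ∑ᴿ-empty
  sumR-tabulate {suc n} f = ≈-trans (+-congˡ (sumR-tabulate (f ∘ suc))) (≈-sym (∑ᴿ-suc f))

  letters : ∀ m → List (Maybe (Fin m))
  letters m = nothing ∷ List.map just (List.allFin m)

  sumR-letters : (f : Maybe (Fin m) → Carrier) → sumR R (List.map f (letters m)) ≈ ∑M f
  sumR-letters {m} f = ≈-trans (+-congˡ (begin
    sumR R (List.map f (List.map just (List.allFin m)))
      ≈⟨ reflexive (cong (sumR R) (trans (cong (List.map f) (map-tabulate id just)) (map-tabulate just f))) ⟩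
    sumR R (List.tabulate (f ∘ just))
      ≈⟨ sumR-tabulate (f ∘ just) ⟩
    ∑ᴿ (f ∘ just) ∎)) (≈-sym ∑M-unfold)

  sumR-allVecs : ∀ N (f : Board N m → Carrier) → sumR R (List.map f (allVecs N (letters m))) ≈ ∑B N f
  sumR-allVecs         zero    f = +-identityʳ (f [])
  sumR-allVecs {m = m} (suc N) f = begin
    sumR R (List.map f (concatMap (λ a → List.map (a ∷_) (allVecs N (letters m))) (letters m)))
      ≈⟨ sumR-concatMap f (λ a → List.map (a ∷_) (allVecs N (letters m))) (letters m) ⟩
    sumR R (List.map (λ a → sumR R (List.map f (List.map (a ∷_) (allVecs N (letters m))))) (letters m))
      ≈⟨ sumR-letters _ ⟩
    ∑M (λ a → sumR R (List.map f (List.map (a ∷_) (allVecs N (letters m)))))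
      ≈⟨ ∑M-cong (λ a → ≈-trans
           (reflexive (cong (sumR R) (sym (map-∘ {g = f} {f = a ∷_} (allVecs N (letters m))))))
           (sumR-allVecs N (λ v → f (a ∷ v)))) ⟩
    ∑B (suc N) f ∎

  sumR-filterB : ∀ {a} {A : Set a} (p : A → Bool) (f : A → Carrier) as →
    sumR R (List.map f (filterB p as)) ≈ sumR R (List.map (λ a → if p a then f a else 0#) as)
  sumR-filterB p f []       = ≈-refl
  sumR-filterB p f (a ∷ as) with p a
  ... | true  = +-congˡ (sumR-filterB p f as)
  ... | false = ≈-trans (sumR-filterB p f as) (≈-sym (+-identityˡ _))

-- The recurrence

module Recurrence {c ℓ} (R : CommutativeRing c ℓ) (x q y : CommutativeRing.Carrier R) where
  open CommutativeRing R
    hiding (zero) renaming (refl to ≈-refl; sym to ≈-sym; trans to ≈-trans)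
  open BoardSum R
  open import Relation.Binary.Reasoning.Setoid setoid
  open import Algebra.Properties.Ring ring using (-1*x≈-x; -‿distribˡ-*)
  open import Algebra.Solver.Ring.NaturalCoefficients.Default commutativeSemiring
    using (solve; _:=_; _:+_; _:*_)

  private
    _^_ : Carrier → ℕ → Carrier
    _^_ = pow R

  ^-+ : ∀ a k l → a ^ (k +ℕ l) ≈ a ^ k * a ^ l
  ^-+ a zero    l = ≈-sym (*-identityˡ _)
  ^-+ a (suc k) l = ≈-trans (*-congˡ (^-+ a k l)) (≈-sym (*-assoc a _ _))

  -- Reversing the order of summation replaces `opposite i` by `i`.
  ∑ᴿ-powers : ∀ n → ∑ᴿ {n} (λ i → q ^ toℕ (opposite i)) ≈ qint R q n
  ∑ᴿ-powers n = ≈-trans (∑ᴿ-opposite λ i → q ^ toℕ i) (≈-sym (powers n id))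
    where
    -- Stated for any `h` because the tail of `applyUpTo h` is built from `h ∘ suc`.
    powers : ∀ n (h : ℕ → ℕ) → sumR R (List.map (q ^_) (applyUpTo h n)) ≈ ∑ᴿ {n} (λ i → q ^ h (toℕ i))
    powers zero    h = ≈-sym ∑ᴿ-empty
    powers (suc n) h = ≈-trans (+-congˡ (powers n (h ∘ suc))) (≈-sym (∑ᴿ-suc _))

  monomial : (edges nonneg qpower xpower : ℕ) → Carrier
  monomial e b t d = (- 1#) ^ e * y ^ b * q ^ t * x ^ d

  -- On a rectangular board the power of `x` counts the free upper vertices, so a free last lower
  -- vertex leaves the weight alone and a free last upper vertex multiplies it by `x`.
  weight : Board N m → Carrier
  weight {N} v = monomial (edgeCount v) (nonnegCount v) (qExponent v) (N ∸ edgeCount v)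

  matchingTerm : Board N m → Carrier
  matchingTerm v = if does (matching? v) then weight v else 0#

  -- S(n) is `total n n`, and M(n+1) is `total (suc n) n`.
  total : ℕ → ℕ → Carrier
  total N m = ∑B N (matchingTerm {N} {m})

  matchingTerm-zero : (v : Board N m) → ¬ Matching v → matchingTerm v ≈ 0#
  matchingTerm-zero v ¬M = reflexive (cong (if_then weight v else 0#) (dec-false (matching? v) ¬M))

  -- The scaling is asked for under `B` only, so the weight lemmas may assume a matching; otherwise
  -- both sides vanish.
  if-scale : ∀ {A B : Set} (a? : Dec A) (b? : Dec B) {s t : Carrier} (r : Carrier) → A ⇔ B →
    (B → s ≈ r * t) → (if does a? then s else 0#) ≈ r * (if does b? then t else 0#)
  if-scale a? (yes b) {s} {t} r A⇔B eq =
    ≈-trans (reflexive (cong (if_then s else 0#) (dec-true a? (Equivalence.from A⇔B b)))) (eq b)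
  if-scale a? (no ¬b) {s} {t} r A⇔B eq =
    ≈-trans (reflexive (cong (if_then s else 0#) (dec-false a? (¬b ∘ Equivalence.to A⇔B))))
      (≈-sym (zeroʳ r))

  weight-addLower-last : (v : Board N m) → weight (addLower (fromℕ m) v) ≡ weight v
  weight-addLower-last {N} {m} v
    rewrite edgeSum-addLower-last (λ _ _ → 1) v
          | edgeSum-addLower-last nonnegTerm v
          | edgeSum-addLower-last diffTerm v
          | crossings-addLower (fromℕ m) v = refl

  weight-addUpper-last : (v : Board N m) → weight (addUpper (fromℕ N) v) ≈ x * weight v
  weight-addUpper-last {N} v
    rewrite edgeSum-addUpper-last (λ _ _ → 1) v
          | edgeSum-addUpper-last nonnegTerm v
          | edgeSum-addUpper-last diffTerm v
          | crossings-addUpper (fromℕ N) v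
          -- With at most `N` edges the subtraction is exact, and one more upper vertex raises the
          -- power of `x` by one.
          | ℕₚ.+-∸-assoc 1 (edgeCount≤ v) =
    solve 3 (λ a b c → a :* (b :* c) := b :* (a :* c)) ≈-refl _ x _

  edgeCount-addEdge : (i : Fin (suc N)) (j : Fin (suc m)) (v : Board N m) →
    edgeCount (addEdge i j v) ≡ suc (edgeCount v)
  edgeCount-addEdge = edgeSum-addEdge λ _ _ → 1

  -- The sign of the new edge and the `y` of its nonnegative block difference combine to `- y`. The
  -- power of `x` stays, since vertices and edges both grow by one.
  weight-addEdge-lower : (i : Fin (suc n)) (v : Board n n) → Matching v →
    weight (addEdge i (fromℕ n) v) ≈ (- y * q ^ toℕ (opposite i)) * weight v
  weight-addEdge-lower {n} i v M
    rewrite edgeCount-addEdge i (fromℕ n) v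
          | LastLower.nonnegCount-add i v M
          | LastLower.qExponent-add i v M = begin
    (- 1# * e) * (y * b) * q ^ (toℕ (opposite i) +ℕ qExponent v) * d
      ≈⟨ *-congʳ (*-congˡ (^-+ q (toℕ (opposite i)) (qExponent v))) ⟩
    (- 1# * e) * (y * b) * (p * t) * d
      -- Minus one enters the natural-coefficient solver as an indeterminate.
      ≈⟨ solve 7 (λ o e y b p t d →
           o :* e :* (y :* b) :* (p :* t) :* d := o :* y :* p :* (e :* b :* t :* d)) ≈-refl (- 1#) e y b p t d ⟩
    - 1# * y * p * (e * b * t * d)
      ≈⟨ *-congʳ (*-congʳ (-1*x≈-x y)) ⟩
    - y * p * (e * b * t * d) ∎
    where
    e = (- 1#) ^ edgeCount v
    b = y ^ nonnegCount v
    p = q ^ toℕ (opposite i)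
    t = q ^ qExponent v
    d = x ^ (n ∸ edgeCount v)

  weight-addEdge-upper : (j : Fin (suc m)) (v : Board (suc m) m) → Matching v →
    weight (addEdge (fromℕ (suc m)) j v) ≈ (- 1# * q ^ toℕ (opposite j)) * weight v
  weight-addEdge-upper {m} j v M
    rewrite edgeCount-addEdge (fromℕ (suc m)) j v
          | LastUpper.nonnegCount-add j v M
          | LastUpper.qExponent-add j v M = begin
    (- 1# * e) * b * q ^ (toℕ (opposite j) +ℕ qExponent v) * d
      ≈⟨ *-congʳ (*-congˡ (^-+ q (toℕ (opposite j)) (qExponent v))) ⟩
    (- 1# * e) * b * (p * t) * d
      ≈⟨ solve 6 (λ o e b p t d →
           o :* e :* b :* (p :* t) :* d := o :* p :* (e :* b :* t :* d)) ≈-refl (- 1#) e b p t d ⟩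
    - 1# * p * (e * b * t * d) ∎
    where
    e = (- 1#) ^ edgeCount v
    b = y ^ nonnegCount v
    p = q ^ toℕ (opposite j)
    t = q ^ qExponent v
    d = x ^ (suc m ∸ edgeCount v)

  ∑ᴿ-weights : ∀ n {f : Fin n → Carrier} (a b : Carrier) →
    (∀ i → f i ≈ (a * q ^ toℕ (opposite i)) * b) → ∑ᴿ f ≈ a * qint R q n * b
  ∑ᴿ-weights n {f} a b eq = begin
    ∑ᴿ f                                           ≈⟨ ∑ᴿ-cong eq ⟩
    ∑ᴿ (λ i → (a * q ^ toℕ (opposite i)) * b)  ≈⟨ ∑ᴿ-distribʳ _ b ⟩
    ∑ᴿ (λ i → a * q ^ toℕ (opposite i)) * b    ≈⟨ *-congʳ (∑ᴿ-distribˡ _ a) ⟩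
    a * ∑ᴿ (λ i → q ^ toℕ (opposite i)) * b    ≈⟨ *-congʳ (*-congˡ (∑ᴿ-powers n)) ⟩
    a * qint R q n * b                             ∎

  split-last-lower : ∀ n →
    total (suc n) (suc n) ≈ total (suc n) n + - y * qint R q (suc n) * total n n
  split-last-lower n = ≈-trans
    -- Two edges at the last lower vertex violate `Matching`, so such boards contribute zero.
    (∑B-once (suc n) (fromℕ n) matchingTerm λ v k l k≢l p r →
      matchingTerm-zero v λ M → k≢l (M k l (fromℕ n) p r))
    (+-cong
      (∑B-cong (suc n) λ v → ≈-trans
        (if-scale (matching? (addLower (fromℕ n) v)) (matching? v) 1# (matching-addLower (fromℕ n) v)
          λ _ → ≈-trans (reflexive (weight-addLower-last v)) (≈-sym (*-identityˡ _)))
        (*-identityˡ _))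
      (∑ᴿ-weights (suc n) (- y) (total n n) λ i → ≈-trans
        (∑B-cong n λ v → if-scale (matching? (addEdge i (fromℕ n) v)) (matching? v) _
          (matching-addEdge i (fromℕ n) v) (weight-addEdge-lower i v))
        (∑B-distribˡ n matchingTerm _)))

  addUpper-total : ∀ n m →
    ∑B n (λ v → matchingTerm (addUpper {m = m} (fromℕ n) v)) ≈ x * total n m
  addUpper-total n m = ≈-trans
    (∑B-cong n λ v → if-scale (matching? (addUpper (fromℕ n) v)) (matching? v) x
      (matching-addUpper (fromℕ n) v) λ _ → weight-addUpper-last v)
    (∑B-distribˡ n matchingTerm x)

  split-last-upper : ∀ m →
    total (suc (suc m)) (suc m) ≈ x * total (suc m) (suc m) + - 1# * qint R q (suc m) * total (suc m) m
  split-last-upper m = ≈-trans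
    (≈-trans (∑B-insertAt (suc m) last matchingTerm) ∑M-unfold)
    (+-cong
      (addUpper-total (suc m) (suc m))
      (∑ᴿ-weights (suc m) (- 1#) (total (suc m) m) λ j → begin
        ∑B (suc m) (λ v → matchingTerm (insertAt v last (just j)))
          -- Once the last upper vertex is joined to `j`, another entry `just j` would clash, so the
          -- remaining entries are raised past `j`.
          ≈⟨ ∑B-avoid (suc m) j _ (λ v k eq → matchingTerm-zero (insertAt v last (just j)) λ M →
               punchInᵢ≢i last k (M (punchIn last k) last j
                 (trans (insertAt-punchIn v last (just j) k) eq) (insertAt-lookup v last (just j)))) ⟩
        ∑B (suc m) (λ v → matchingTerm (addEdge last j v))
          ≈⟨ ∑B-cong (suc m) (λ v → if-scale (matching? (addEdge last j v)) (matching? v) _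
               (matching-addEdge last j v) (weight-addEdge-upper j v)) ⟩
        ∑B (suc m) (λ v → - 1# * q ^ toℕ (opposite j) * matchingTerm v)
          ≈⟨ ∑B-distribˡ (suc m) matchingTerm _ ⟩
        - 1# * q ^ toℕ (opposite j) * total (suc m) m ∎))
    where last = fromℕ (suc m)

  -- Without lower vertices the last upper vertex can only be free. This starts the recurrence at
  -- degree one.
  split-last-upper-empty : ∀ n → total (suc n) 0 ≈ x * total n 0
  split-last-upper-empty n = begin
    total (suc n) 0
      ≈⟨ ∑B-insertAt n (fromℕ n) matchingTerm ⟩
    ∑M (λ a → ∑B n (λ v → matchingTerm (insertAt v (fromℕ n) a)))
      ≈⟨ ≈-trans ∑M-unfold (+-congˡ ∑ᴿ-empty) ⟩
    ∑B n (λ v → matchingTerm (addUpper (fromℕ n) v)) + 0#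
      ≈⟨ ≈-trans (+-identityʳ _) (addUpper-total n 0) ⟩
    x * total n 0 ∎

  total-zero : total 0 0 ≈ 1#
  total-zero = ≈-trans (reflexive weight-[])
    (≈-trans (*-identityʳ _) (≈-trans (*-identityʳ _) (*-identityʳ _)))
    where
    weight-[] : weight {0} {0} [] ≡ monomial 0 0 0 0
    weight-[] = trans
      (cong (λ e → monomial e (nonnegCount {0} {0} []) (qExponent {0} {0} []) (0 ∸ e)) (edgeSum-[] λ _ _ → 1))
      (cong₂ (λ b t → monomial 0 b t 0) (edgeSum-[] nonnegTerm) (cong₂ _+ℕ_ (edgeSum-[] diffTerm) ∑-empty))

  qLaguerre-total : ∀ n → qLaguerre R x q y n ≈ total n n
  qLaguerre-total zero          = ≈-sym total-zero
  qLaguerre-total (suc zero)    = ≈-sym (begin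
    total 1 1
      ≈⟨ split-last-lower 0 ⟩
    total 1 0 + - y * (1# + 0#) * total 0 0
      ≈⟨ +-cong (≈-trans (split-last-upper-empty 0) (*-congˡ total-zero)) (*-congˡ total-zero) ⟩
    x * 1# + - y * (1# + 0#) * 1#
      ≈⟨ +-cong (*-identityʳ x) (≈-trans (*-identityʳ _) (≈-trans (*-congˡ (+-identityʳ 1#)) (*-identityʳ (- y)))) ⟩
    x - y ∎)
  qLaguerre-total (suc (suc m)) = begin
    (x - y * Q′ - Q) * qLaguerre R x q y (suc m) - y * (Q * Q) * qLaguerre R x q y m
      ≈⟨ +-cong (*-congˡ (qLaguerre-total (suc m))) (-‿cong (*-congˡ (qLaguerre-total m))) ⟩
    (x - y * Q′ - Q) * S - y * (Q * Q) * P
      -- Negations are moved onto the factors `y` and `Q`, so that the solver can take `- y * Q′`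
      -- and `- Q` as indeterminates.
      ≈⟨ +-cong (*-congʳ (+-congʳ (+-congˡ (-‿distribˡ-* y Q′)))) (begin
           - (y * (Q * Q) * P)  ≈⟨ -‿cong (solve 3 (λ y Q P → y :* (Q :* Q) :* P := Q :* (y :* Q :* P)) ≈-refl y Q P) ⟩
           - (Q * (y * Q * P))  ≈⟨ -‿distribˡ-* Q _ ⟩
           - Q * (y * Q * P)    ∎) ⟩
    (x + - y * Q′ + - Q) * S + - Q * (y * Q * P)
      ≈⟨ solve 5 (λ x a b S c → (x :+ a :+ b) :* S :+ b :* c := x :* S :+ b :* (S :+ c) :+ a :* S)
           ≈-refl x (- y * Q′) (- Q) S (y * Q * P) ⟩
    x * S + - Q * (S + y * Q * P) + - y * Q′ * S
      -- Solving the lower splitting of `S` for `U` identifies `S + y * Q * P` with the rectangular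
      -- sum.
      ≈⟨ +-congʳ (+-congˡ (*-cong (≈-sym (-1*x≈-x Q)) (begin
           S + y * Q * P                     ≈⟨ +-congʳ (split-last-lower m) ⟩
           U + - y * Q * P + y * Q * P       ≈⟨ +-assoc U _ _ ⟩
           U + (- y * Q * P + y * Q * P)     ≈⟨ +-congˡ (≈-trans (≈-sym (distribʳ P _ _)) (*-congʳ (≈-sym (distribʳ Q _ _)))) ⟩
           U + (- y + y) * Q * P             ≈⟨ +-congˡ (*-congʳ (*-congʳ (-‿inverseˡ y))) ⟩
           U + 0# * Q * P                    ≈⟨ +-congˡ (≈-trans (*-congʳ (zeroˡ Q)) (zeroˡ P)) ⟩
           U + 0#                            ≈⟨ +-identityʳ U ⟩
           U                                 ∎))) ⟩
    x * S + - 1# * Q * U + - y * Q′ * S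
      ≈⟨ +-congʳ (split-last-upper m) ⟨
    total (suc (suc m)) (suc m) + - y * Q′ * S
      ≈⟨ split-last-lower (suc m) ⟨
    total (suc (suc m)) (suc (suc m)) ∎
    where
    Q′ = qint R q (suc (suc m))
    Q  = qint R q (suc m)
    S  = total (suc m) (suc m)
    P  = total m m
    U  = total (suc m) m

-- Comparison with the definitions on vectors of edges

count-tabulate : (p : A → Bool) (f : Fin n → A) → count p (List.tabulate f) ≡ ∑ (λ i → ⟦ p (f i) ⟧)
count-tabulate {n = zero}  p f = sym ∑-empty
count-tabulate {n = suc n} p f = trans (unfold (p (f zero)))
  (trans (cong (⟦ p (f zero) ⟧ +ℕ_) (count-tabulate p (f ∘ suc))) (sym (∑-suc _)))
  where
  unfold : ∀ b {k} → (if b then suc k else k) ≡ ⟦ b ⟧ +ℕ k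
  unfold true  = refl
  unfold false = refl

count-allFin : (p : Fin n → Bool) → count p (List.allFin n) ≡ ∑ (λ i → ⟦ p i ⟧)
count-allFin p = count-tabulate p id

sumℕ-tabulate : (f : Fin n → ℕ) → sumℕ (List.tabulate f) ≡ ∑ f
sumℕ-tabulate {zero}  f = sym ∑-empty
sumℕ-tabulate {suc n} f = trans (cong (f zero +ℕ_) (sumℕ-tabulate (f ∘ suc))) (sym (∑-suc f))

sumℕ-allFin : (f : Fin n → ℕ) → sumℕ (List.map f (List.allFin n)) ≡ ∑ f
sumℕ-allFin f = trans (cong sumℕ (map-tabulate id f)) (sumℕ-tabulate f)

anyB-tabulate : {P : Fin n → Set} (P? : ∀ i → Dec (P i)) (p : A → Bool) (f : Fin n → A) →
  (∀ i → p (f i) ≡ does (P? i)) → anyB p (List.tabulate f) ≡ does (any? P?)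
anyB-tabulate {n = zero}  P? p f eq = refl
anyB-tabulate {n = suc n} P? p f eq = cong₂ _∨_ (eq zero) (anyB-tabulate (P? ∘ suc) p (f ∘ suc) (eq ∘ suc))

anyB-allFin : {P : Fin n → Set} (P? : ∀ i → Dec (P i)) {p : Fin n → Bool} →
  (∀ i → p i ≡ does (P? i)) → anyB p (List.allFin n) ≡ does (any? P?)
anyB-allFin P? {p} = anyB-tabulate P? p id

sameJust-sound : (a b : Maybe (Fin n)) → T (sameJust a b) → ∃ λ c → a ≡ just c × b ≡ just c
sameJust-sound (just c) (just d) t = c , refl , cong just (sym (toℕ-injective (ℕₚ.≡ᵇ⇒≡ (toℕ c) (toℕ d) t)))

sameJust-complete : {a b : Maybe (Fin n)} {c : Fin n} → a ≡ just c → b ≡ just c → T (sameJust a b)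
sameJust-complete {c = c} refl refl = ℕₚ.≡⇒≡ᵇ (toℕ c) (toℕ c) refl

lowerUnmatched-lowerFree : (π : PMap n) (c : Fin n) → lowerUnmatched π c ≡ lowerFree π c
lowerUnmatched-lowerFree π c = cong not (anyB-allFin (λ k → lookup π k ≟M just c) λ k →
  does-⇔ (mk⇔ (to k) (λ eq → sameJust-complete eq refl)) (T? (sameJust (lookup π k) (just c))) (lookup π k ≟M just c))
  where
  to : ∀ k → T (sameJust (lookup π k) (just c)) → lookup π k ≡ just c
  to k t with sameJust-sound (lookup π k) (just c) t
  ... | d , eq , refl = eq

-- The Boolean test inspects pairs with `i` below `k` only, whereas `Matching` ranges over all
-- pairs; trichotomy and the symmetry of a clash bridge the two.
isMatching-matching? : (π : PMap n) → isMatching π ≡ does (matching? π)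
isMatching-matching? {n} π = trans
  (cong not (anyB-allFin clash? λ i → anyB-allFin (λ k → T? (clash i k)) λ k → refl))
  (does-⇔ (mk⇔ to from) (¬? (any? clash?)) (matching? π))
  where
  clash : Fin n → Fin n → Bool
  clash i k = (i <F k) ∧ sameJust (lookup π i) (lookup π k)
  clash? : ∀ i → Dec (∃ λ k → T (clash i k))
  clash? i = any? λ k → T? (clash i k)
  to : ¬ (∃ λ i → ∃ λ k → T (clash i k)) → Matching π
  to ¬clash i k c p r with ℕₚ.<-cmp (toℕ i) (toℕ k)
  ... | tri< i<k _ _ = contradiction
    (i , k , Equivalence.from T-∧ (ℕₚ.<⇒<ᵇ i<k , sameJust-complete p r)) ¬clash
  ... | tri≈ _ i≡k _ = toℕ-injective i≡k
  ... | tri> _ _ k<i = contradiction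
    (k , i , Equivalence.from T-∧ (ℕₚ.<⇒<ᵇ k<i , sameJust-complete r p)) ¬clash
  from : Matching π → ¬ (∃ λ i → ∃ λ k → T (clash i k))
  from M (i , k , t) with Equivalence.to T-∧ t
  ... | i<ᵇk , same with sameJust-sound (lookup π i) (lookup π k) same
  ...   | c , p , r with M i k c p r
  ...     | refl = ℕₚ.<-irrefl refl (ℕₚ.<ᵇ⇒< (toℕ i) (toℕ i) i<ᵇk)

bindU-blockU : (π : PMap n) (i : Fin n) → bindU π i ≡ suc (blockU π i)
bindU-blockU π i = cong suc (count-allFin _)

bindL-blockL : (π : PMap n) (j : Fin n) → bindL π j ≡ suc (blockL π j)
bindL-blockL π j = cong suc (trans (count-allFin _)
  (∑-cong λ c → cong (λ b → ⟦ b ∧ (c <F j) ⟧) (lowerUnmatched-lowerFree π c)))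

edges-edgeCount : (π : PMap n) → edges π ≡ edgeCount π
edges-edgeCount {n} π = trans (count-allFin _) (∑-cong λ i → pointwise (lookup π i))
  where
  pointwise : (a : Maybe (Fin n)) → ⟦ isJust a ⟧ ≡ onEdge (λ _ → 1) a
  pointwise (just _) = refl
  pointwise nothing  = refl

-- The summands of bwex, bwt and cross are local to their definitions and cannot be named here:
-- each pointwise left-hand side is inferred from the use preceding it.
mutual
  bwex-nonnegCount : (π : PMap n) → bwex π ≡ nonnegCount π
  bwex-nonnegCount π = trans (count-allFin _) (∑-cong (bwex-pointwise π))

  bwex-pointwise : (π : PMap n) (i : Fin n) →
    _ ≡ onEdge (λ j → nonnegTerm (blockU π i) (blockL π j)) (lookup π i)
  bwex-pointwise π i with lookup π i
  -- Both block indices exceed the zero-based ones by one, and the comparison cancels the common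
  -- successor.
  ... | just j  = cong₂ (λ a b → ⟦ not (b <ᵇ a) ⟧) (bindU-blockU π i) (bindL-blockL π j)
  ... | nothing = refl

mutual
  bwt-diffTerm : (π : PMap n) → bwt π ≡ edgeSum diffTerm π
  bwt-diffTerm π = trans (sumℕ-allFin _) (∑-cong (bwt-pointwise π))

  bwt-pointwise : (π : PMap n) (i : Fin n) →
    _ ≡ onEdge (λ j → diffTerm (blockU π i) (blockL π j)) (lookup π i)
  bwt-pointwise π i with lookup π i
  ... | just j  = cong₂ diffTerm (bindU-blockU π i) (bindL-blockL π j)
  ... | nothing = refl

mutual
  cross-crossings : (π : PMap n) → cross π ≡ crossings π
  cross-crossings π = trans (sumℕ-allFin _) (∑-cong λ i →
    trans (count-allFin _) (∑-cong λ k → cong (λ b → ⟦ (i <F k) ∧ b ⟧) (cross-pointwise π i k)))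

  cross-pointwise : (π : PMap n) (i k : Fin n) → _ ≡ crossing (lookup π i) (lookup π k)
  cross-pointwise π i k with lookup π i | lookup π k
  ... | just _  | just _  = refl
  ... | just _  | nothing = refl
  ... | nothing | just _  = refl
  ... | nothing | nothing = refl

module _ {c ℓ} (R : CommutativeRing c ℓ) (x q y : CommutativeRing.Carrier R) where
  open CommutativeRing R using (_≈_; 0#; setoid; reflexive)
  open BoardSum R
  open Recurrence R x q y
  open import Relation.Binary.Reasoning.Setoid setoid

  matchingWeight-weight : (π : PMap n) → matchingWeight R x q y n π ≡ weight π
  matchingWeight-weight {n} π = trans
    (cong (λ e → monomial e (bwex π) (bwt π +ℕ cross π) (n ∸ e)) (edges-edgeCount π))
    (cong₂ (λ b t → monomial (edgeCount π) b t (n ∸ edgeCount π))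
      (bwex-nonnegCount π) (cong₂ _+ℕ_ (bwt-diffTerm π) (cross-crossings π)))

  matchingSum-total : ∀ n → matchingSum R x q y n ≈ total n n
  matchingSum-total n = begin
    matchingSum R x q y n
      ≈⟨ sumR-filterB isMatching (matchingWeight R x q y n) (allVecs n (letters n)) ⟩
    sumR R (List.map (λ π → if isMatching π then matchingWeight R x q y n π else 0#) (allVecs n (letters n)))
      ≈⟨ sumR-allVecs n _ ⟩
    ∑B n (λ π → if isMatching π then matchingWeight R x q y n π else 0#)
      ≈⟨ ∑B-cong n (λ π → reflexive
           (cong₂ (if_then_else 0#) (isMatching-matching? π) (matchingWeight-weight π))) ⟩
    total n n ∎

theorem2p4 : ∀ {c ℓ} (R : CommutativeRing c ℓ) (x q y : CommutativeRing.Carrier R) (n : ℕ) →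
    CommutativeRing._≈_ R (qLaguerre R x q y n) (matchingSum R x q y n)
theorem2p4 R x q y n = CommutativeRing.trans R (Recurrence.qLaguerre-total R x q y n)
  (CommutativeRing.sym R (matchingSum-total R x q y n))
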